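{- Let $k \ge 3$, let $r_1 \geq r_2 \geq \cdots \geq r_k\ge 1$ be integers, and let $n = \sum_{i=1}^{k} r_i$. Then $A(r_1, r_2, \ldots, r_k) \leq 2(n - r_1 - 1)$.
   Context: $A(r_1,r_2,\dots,r_k)$ denotes the minimum, over all choices of pairwise disjoint sets $\mathcal P_1,\dots,\mathcal P_k\subset\mathbb{R}^2$ with $|\mathcal P_i| = r_i$ and whose union is not all collinear, of the number of distinct values in $(0,\pi)$ of angles $\angle xyz$ whose three points $x,y,z$ lie in three distinct sets among $\mathcal P_1,\dots,\mathcal P_k$. -}

module Defs where

open import Data.Fin.Base using (Fin)
open import Data.Integer.Base as ℤ using (+_)
import Data.Integer.Properties as ℤₚ
open import Data.Nat.Coprimality as Coprime using (1-coprimeTo)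
open import Data.Nat.Base as ℕ using (ℕ; zero; suc)
import Data.Nat.Properties as ℕₚ
open import Data.Product.Base using (∃; Σ-syntax; ∃-syntax; _×_; _,_; uncurry)
open import Data.Rational as ℚ using (ℚ; 0ℚ; 1ℚ; ½)
import Data.Rational.Properties as ℚₚ
import Data.Rational.Unnormalised.Base as ℚᵘ
import Data.Rational.Unnormalised.Properties as ℚᵘₚ
open import Data.Rational.Solver using (module +-*-Solver)
open import Data.Sum.Base using (inj₁; inj₂)
open import Data.Vec.Base using (Vec; lookup)
open import Function.Definitions using (Injective)
open import Relation.Binary.PropositionalEquality
  using (_≡_; _≢_; refl; sym; trans; cong; cong₂; subst; subst₂)
open import Relation.Nullary using (¬_; yes; no; contradiction)

------------------------------------------------------------------------
-- Rational preliminaries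

-- Total reciprocal, with the junk value inv 0 = 0.
inv : ℚ → ℚ
inv q with q ℚₚ.≟ 0ℚ
... | yes _  = 0ℚ
... | no q≢0 = (ℚ.1/ q) {{ℚ.≢-nonZero q≢0}}

-- The left Riemann sum of f over [a , b] with 2ⁿ equal subintervals.
riemann : ℕ → (ℚ → ℚ) → ℚ → ℚ → ℚ
riemann zero    f a b = f a ℚ.* (b ℚ.- a)
riemann (suc n) f a b = riemann n f a m ℚ.+ riemann n f m b
  where m = (a ℚ.+ b) ℚ.* ½

-- arctan t = ∫₀ᵗ du / (1 + u²) = ∫₀¹ t ds / (1 + (t s)²).
arctanIntegrand : ℚ → ℚ → ℚ
arctanIntegrand t s = t ℚ.* inv (1ℚ ℚ.+ (t ℚ.* s) ℚ.* (t ℚ.* s))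

arctanApprox : ℕ → ℚ → ℚ
arctanApprox n t = riemann n (arctanIntegrand t) 0ℚ 1ℚ

------------------------------------------------------------------------
-- Estimates used to see that the real operations below are well defined

module Estimates where

  open import Data.Rational using (_+_; _*_; _-_; -_; ∣_∣; _≤_; _<_)
  open +-*-Solver using (solve; _:=_; _:+_; _:*_; _:-_; :-_; con)

  abs≤ : ∀ {p q} → p ≤ q → - p ≤ q → ∣ p ∣ ≤ q
  abs≤ {p} a b with ℚₚ.∣p∣≡p∨∣p∣≡-p p
  ... | inj₁ e = subst (_≤ _) (sym e) a
  ... | inj₂ e = subst (_≤ _) (sym e) b

  ≤abs : ∀ p → p ≤ ∣ p ∣
  ≤abs p with ℚₚ.≤-total 0ℚ p
  ... | inj₁ 0≤p = ℚₚ.≤-reflexive (sym (ℚₚ.0≤p⇒∣p∣≡p 0≤p))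
  ... | inj₂ p≤0 = ℚₚ.≤-trans p≤0 (ℚₚ.0≤∣p∣ p)

  abs-sym : ∀ p q → ∣ p - q ∣ ≡ ∣ q - p ∣
  abs-sym p q = trans (sym (ℚₚ.∣-p∣≡∣p∣ (p - q)))
    (cong ∣_∣ (solve 2 (λ p q → :- (p :- q) := q :- p) refl p q))

  tri : ∀ p q r → ∣ p - r ∣ ≤ ∣ p - q ∣ + ∣ q - r ∣
  tri p q r = subst (λ z → ∣ z ∣ ≤ ∣ p - q ∣ + ∣ q - r ∣)
    (solve 3 (λ p q r → (p :- q) :+ (q :- r) := p :- r) refl p q r)
    (ℚₚ.∣p+q∣≤∣p∣+∣q∣ (p - q) (q - r))

  abs-abs : ∀ p q → ∣ ∣ p ∣ - ∣ q ∣ ∣ ≤ ∣ p - q ∣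
  abs-abs p q = abs≤ (one p q) (subst₂ _≤_
      (solve 2 (λ a b → b :- a := :- (a :- b)) refl ∣ p ∣ ∣ q ∣) (abs-sym q p) (one q p))
    where
    one : ∀ p q → ∣ p ∣ - ∣ q ∣ ≤ ∣ p - q ∣
    one p q = subst (∣ p ∣ - ∣ q ∣ ≤_)
      (solve 2 (λ a b → (a :+ b) :- b := a) refl ∣ p - q ∣ ∣ q ∣)
      (ℚₚ.+-monoˡ-≤ (- ∣ q ∣) (subst (λ z → ∣ z ∣ ≤ ∣ p - q ∣ + ∣ q ∣)
        (solve 2 (λ p q → (p :- q) :+ q := p) refl p q)
        (ℚₚ.∣p+q∣≤∣p∣+∣q∣ (p - q) q)))

  *-mono : ∀ {p q r s} → 0ℚ ≤ p → 0ℚ ≤ s → p ≤ q → r ≤ s → p * r ≤ q * s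
  *-mono {p} {q} {r} {s} 0≤p 0≤s p≤q r≤s = ℚₚ.≤-trans
    (ℚₚ.*-monoˡ-≤-nonNeg p {{ℚ.nonNegative 0≤p}} r≤s)
    (ℚₚ.*-monoʳ-≤-nonNeg s {{ℚ.nonNegative 0≤s}} p≤q)

  *-pos : ∀ {p q} → 0ℚ < p → 0ℚ < q → 0ℚ < p * q
  *-pos {p} {q} 0<p 0<q = subst (_< p * q) (ℚₚ.*-zeroʳ p)
    (ℚₚ.*-monoʳ-<-pos p {{ℚ.positive 0<p}} 0<q)

  *-nonneg : ∀ {p q} → 0ℚ ≤ p → 0ℚ ≤ q → 0ℚ ≤ p * q
  *-nonneg {p} {q} 0≤p 0≤q = subst (_≤ p * q) (ℚₚ.*-zeroʳ p)
    (ℚₚ.*-monoˡ-≤-nonNeg p {{ℚ.nonNegative 0≤p}} 0≤q)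

  0≤sq : ∀ p → 0ℚ ≤ p * p
  0≤sq p with ℚₚ.≤-total 0ℚ p
  ... | inj₁ 0≤p = *-nonneg 0≤p 0≤p
  ... | inj₂ p≤0 = subst (0ℚ ≤_) (solve 1 (λ p → (:- p) :* (:- p) := p :* p) refl p)
                     (*-nonneg 0≤-p 0≤-p)
    where
    0≤-p : 0ℚ ≤ - p
    0≤-p = ℚₚ.neg-antimono-≤ p≤0

  0<½ : 0ℚ < ½
  0<½ = ℚₚ.positive⁻¹ ½

  0<1 : 0ℚ < 1ℚ
  0<1 = ℚₚ.positive⁻¹ 1ℚ

  halves : ∀ ε → ε * ½ + ε * ½ ≡ ε
  halves ε = solve 1 (λ ε → ε :* con ½ :+ ε :* con ½ := ε) refl ε

  half-pos : ∀ {ε} → 0ℚ < ε → 0ℚ < ε * ½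
  half-pos 0<ε = *-pos 0<ε 0<½

  inv-*ʳ : ∀ {q} → 0ℚ < q → q * inv q ≡ 1ℚ
  inv-*ʳ {q} 0<q with q ℚₚ.≟ 0ℚ
  ... | yes refl = contradiction 0<q (ℚₚ.<-irrefl refl)
  ... | no q≢0   = ℚₚ.*-inverseʳ q {{ℚ.≢-nonZero q≢0}}

  inv-pos : ∀ {q} → 0ℚ < q → 0ℚ < inv q
  inv-pos {q} 0<q with q ℚₚ.≟ 0ℚ
  ... | yes refl = contradiction 0<q (ℚₚ.<-irrefl refl)
  ... | no q≢0   = ℚₚ.positive⁻¹ _ {{ℚₚ.1/pos⇒pos q {{ℚ.positive 0<q}}}}

  -- |p/a − q/b| ≤ K as soon as |p b − q a| ≤ K a b
  frac-diff : ∀ {a b} p q K → 0ℚ < a → 0ℚ < b →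
              ∣ p * b - q * a ∣ ≤ K * (a * b) → ∣ p * inv a - q * inv b ∣ ≤ K
  frac-diff {a} {b} p q K 0<a 0<b h =
    ℚₚ.*-cancelʳ-≤-pos (a * b) {{ℚ.positive 0<ab}} (subst (_≤ K * (a * b)) eq h)
    where
    0<ab : 0ℚ < a * b
    0<ab = *-pos 0<a 0<b
    expand : (p * inv a - q * inv b) * (a * b) ≡ p * b - q * a
    expand = trans
      (solve 6 (λ p q a b a' b' → (p :* a' :- q :* b') :* (a :* b)
                  := (p :* b) :* (a :* a') :- (q :* a) :* (b :* b'))
         refl p q a b (inv a) (inv b))
      (cong₂ _-_ {_} {p * b} {_} {q * a}
        (trans (cong ((p * b) *_) (inv-*ʳ 0<a)) (ℚₚ.*-identityʳ (p * b)))
        (trans (cong ((q * a) *_) (inv-*ʳ 0<b)) (ℚₚ.*-identityʳ (q * a))))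
    eq : ∣ p * b - q * a ∣ ≡ ∣ p * inv a - q * inv b ∣ * (a * b)
    eq = trans (cong ∣_∣ (sym expand))
        (trans (ℚₚ.∣p*q∣≡∣p∣*∣q∣ (p * inv a - q * inv b) (a * b))
               (cong (∣ p * inv a - q * inv b ∣ *_) (ℚₚ.0≤p⇒∣p∣≡p (ℚₚ.<⇒≤ 0<ab))))

  ≤-by : ∀ {p q} r → 0ℚ ≤ r → p + r ≡ q → p ≤ q
  ≤-by {p} r 0≤r e = subst (p ≤_) e
    (subst (_≤ p + r) (ℚₚ.+-identityʳ p) (ℚₚ.+-monoʳ-≤ p 0≤r))

  den : ℚ → ℚ
  den p = 1ℚ + p * p

  0<den : ∀ p → 0ℚ < den p
  0<den p = ℚₚ.<-≤-trans 0<1 (≤-by (p * p) (0≤sq p) refl)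

  0≤+ : ∀ {p q} → 0ℚ ≤ p → 0ℚ ≤ q → 0ℚ ≤ p + q
  0≤+ = ℚₚ.+-mono-≤

  0≤½ : 0ℚ ≤ ½
  0≤½ = ℚₚ.<⇒≤ 0<½

  ∣1-pq∣≤ : ∀ p q → ∣ 1ℚ - p * q ∣ ≤ den p * den q
  ∣1-pq∣≤ p q = abs≤
    (≤-by (½ * (p * p + q * q + (p + q) * (p + q)) + (p * q) * (p * q))
       (0≤+ (*-nonneg 0≤½ (0≤+ (0≤+ (0≤sq p) (0≤sq q)) (0≤sq (p + q)))) (0≤sq (p * q)))
       (solve 2 (λ p q → (con 1ℚ :- p :* q)
            :+ (con ½ :* (p :* p :+ q :* q :+ (p :+ q) :* (p :+ q)) :+ (p :* q) :* (p :* q))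
          := (con 1ℚ :+ p :* p) :* (con 1ℚ :+ q :* q)) refl p q))
    (≤-by (½ * (p * p + q * q + (p - q) * (p - q)) + (1ℚ + 1ℚ + (p * q) * (p * q)))
       (0≤+ (*-nonneg 0≤½ (0≤+ (0≤+ (0≤sq p) (0≤sq q)) (0≤sq (p - q))))
            (0≤+ (0≤+ (ℚₚ.<⇒≤ 0<1) (ℚₚ.<⇒≤ 0<1)) (0≤sq (p * q))))
       (solve 2 (λ p q → (:- (con 1ℚ :- p :* q))
            :+ (con ½ :* (p :* p :+ q :* q :+ (p :- q) :* (p :- q))
               :+ (con 1ℚ :+ con 1ℚ :+ (p :* q) :* (p :* q)))
          := (con 1ℚ :+ p :* p) :* (con 1ℚ :+ q :* q)) refl p q))

  ∣p+q∣≤den : ∀ p q → ∣ p + q ∣ ≤ den p * den q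
  ∣p+q∣≤den p q = abs≤
    (≤-by ((p - ½) * (p - ½) + (q - ½) * (q - ½) + ½ + (p * q) * (p * q))
       (0≤+ (0≤+ (0≤+ (0≤sq (p - ½)) (0≤sq (q - ½))) 0≤½) (0≤sq (p * q)))
       (solve 2 (λ p q → (p :+ q) :+ ((p :- con ½) :* (p :- con ½)
            :+ (q :- con ½) :* (q :- con ½) :+ con ½ :+ (p :* q) :* (p :* q))
          := (con 1ℚ :+ p :* p) :* (con 1ℚ :+ q :* q)) refl p q))
    (≤-by ((p + ½) * (p + ½) + (q + ½) * (q + ½) + ½ + (p * q) * (p * q))
       (0≤+ (0≤+ (0≤+ (0≤sq (p + ½)) (0≤sq (q + ½))) 0≤½) (0≤sq (p * q)))
       (solve 2 (λ p q → (:- (p :+ q)) :+ ((p :+ con ½) :* (p :+ con ½)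
            :+ (q :+ con ½) :* (q :+ con ½) :+ con ½ :+ (p :* q) :* (p :* q))
          := (con 1ℚ :+ p :* p) :* (con 1ℚ :+ q :* q)) refl p q))

  ∣∣-* : ∀ {p q c d} → ∣ p ∣ ≤ c → ∣ q ∣ ≤ d → ∣ p * q ∣ ≤ c * d
  ∣∣-* {p} {q} hp hq = subst (_≤ _) (sym (ℚₚ.∣p*q∣≡∣p∣*∣q∣ p q))
    (*-mono (ℚₚ.0≤∣p∣ p) (ℚₚ.≤-trans (ℚₚ.0≤∣p∣ q) hq) hp hq)

  integrand-lip-t : ∀ t t' s → ∣ arctanIntegrand t s - arctanIntegrand t' s ∣ ≤ ∣ t - t' ∣
  integrand-lip-t t t' s = frac-diff t t' ∣ t - t' ∣ (0<den (t * s)) (0<den (t' * s))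
    (subst (λ z → ∣ z ∣ ≤ ∣ t - t' ∣ * (den (t * s) * den (t' * s)))
       (solve 3 (λ t t' s → (t :- t') :* (con 1ℚ :- (t :* s) :* (t' :* s))
           := t :* (con 1ℚ :+ (t' :* s) :* (t' :* s)) :- t' :* (con 1ℚ :+ (t :* s) :* (t :* s)))
          refl t t' s)
       (∣∣-* {t - t'} ℚₚ.≤-refl (∣1-pq∣≤ (t * s) (t' * s))))

  integrand-lip-s : ∀ t s s' →
    ∣ arctanIntegrand t s - arctanIntegrand t s' ∣ ≤ (∣ t ∣ * ∣ t ∣) * ∣ s - s' ∣
  integrand-lip-s t s s' = frac-diff t t _ (0<den (t * s)) (0<den (t * s'))
    (subst₂ (λ y z → ∣ y ∣ ≤ z)
       (solve 3 (λ t s s' → ((t :* t) :* (s :- s')) :* (:- (t :* s :+ t :* s'))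
           := t :* (con 1ℚ :+ (t :* s') :* (t :* s')) :- t :* (con 1ℚ :+ (t :* s) :* (t :* s)))
          refl t s s')
       refl
       (∣∣-* {(t * t) * (s - s')}
          (∣∣-* {t * t} (∣∣-* {t} {t} ℚₚ.≤-refl ℚₚ.≤-refl) ℚₚ.≤-refl)
          (subst (_≤ den (t * s) * den (t * s')) (sym (ℚₚ.∣-p∣≡∣p∣ (t * s + t * s')))
             (∣p+q∣≤den (t * s) (t * s')))))

  mid : ℚ → ℚ → ℚ
  mid a b = (a + b) * ½

  mid-l : ∀ a b → mid a b - a ≡ (b - a) * ½
  mid-l = solve 2 (λ a b → (a :+ b) :* con ½ :- a := (b :- a) :* con ½) refl

  mid-r : ∀ a b → b - mid a b ≡ (b - a) * ½
  mid-r = solve 2 (λ a b → b :- (a :+ b) :* con ½ := (b :- a) :* con ½) refl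

  0≤-half : ∀ {w} → 0ℚ ≤ w → 0ℚ ≤ w * ½
  0≤-half 0≤w = *-nonneg 0≤w 0≤½

  mid-l≥ : ∀ a b → 0ℚ ≤ b - a → 0ℚ ≤ mid a b - a
  mid-l≥ a b h = subst (0ℚ ≤_) (sym (mid-l a b)) (0≤-half h)

  mid-r≥ : ∀ a b → 0ℚ ≤ b - a → 0ℚ ≤ b - mid a b
  mid-r≥ a b h = subst (0ℚ ≤_) (sym (mid-r a b)) (0≤-half h)

  sum-diff : ∀ a b c d {x y} → ∣ a - c ∣ ≤ x → ∣ b - d ∣ ≤ y → ∣ (a + b) - (c + d) ∣ ≤ x + y
  sum-diff a b c d hx hy = subst (λ z → ∣ z ∣ ≤ _)
    (solve 4 (λ a b c d → (a :- c) :+ (b :- d) := (a :+ b) :- (c :+ d)) refl a b c d)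
    (ℚₚ.≤-trans (ℚₚ.∣p+q∣≤∣p∣+∣q∣ (a - c) (b - d)) (ℚₚ.+-mono-≤ hx hy))

  riemann-perturb : ∀ n f g K → (∀ s → ∣ f s - g s ∣ ≤ K) → ∀ a b → 0ℚ ≤ b - a →
                    ∣ riemann n f a b - riemann n g a b ∣ ≤ K * (b - a)
  riemann-perturb zero f g K h a b 0≤w = subst (λ z → ∣ z ∣ ≤ K * (b - a))
    (solve 3 (λ x y w → (x :- y) :* w := x :* w :- y :* w) refl (f a) (g a) (b - a))
    (∣∣-* {f a - g a} (h a) (ℚₚ.≤-reflexive (ℚₚ.0≤p⇒∣p∣≡p 0≤w)))
  riemann-perturb (suc n) f g K h a b 0≤w = subst (_ ≤_)
    (solve 3 (λ K a b → K :* ((a :+ b) :* con ½ :- a) :+ K :* (b :- (a :+ b) :* con ½)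
       := K :* (b :- a)) refl K a b)
    (sum-diff (riemann n f a (mid a b)) (riemann n f (mid a b) b) (riemann n g a (mid a b)) (riemann n g (mid a b) b)
      (riemann-perturb n f g K h a (mid a b) (mid-l≥ a b 0≤w))
      (riemann-perturb n f g K h (mid a b) b (mid-r≥ a b 0≤w)))

  pow : ℕ → ℚ
  pow zero    = 1ℚ
  pow (suc n) = ½ * pow n

  module _ (f : ℚ → ℚ) (L : ℚ) (0≤L : 0ℚ ≤ L)
           (lip : ∀ s s' → ∣ f s - f s' ∣ ≤ L * ∣ s - s' ∣) where

    riemann-base : ∀ n a b → 0ℚ ≤ b - a →
      ∣ riemann n f a b - f a * (b - a) ∣ ≤ L * ((b - a) * (b - a))
    riemann-base zero a b 0≤w = subst (λ z → ∣ z ∣ ≤ L * ((b - a) * (b - a)))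
      (sym (ℚₚ.+-inverseʳ (f a * (b - a)))) (*-nonneg 0≤L (0≤sq (b - a)))
    riemann-base (suc n) a b 0≤w =
      ℚₚ.≤-trans (tri (riemann (suc n) f a b) (f a * (m - a) + f m * (b - m)) (f a * (b - a)))
        (ℚₚ.≤-trans (ℚₚ.+-mono-≤
            (sum-diff (riemann n f a m) (riemann n f m b) (f a * (m - a)) (f m * (b - m))
              (riemann-base n a m (mid-l≥ a b 0≤w)) (riemann-base n m b (mid-r≥ a b 0≤w)))
            last)
          (≤-by (L * (((b - a) * ½) * ((b - a) * ½)))
             (*-nonneg 0≤L (0≤sq ((b - a) * ½)))
             (solve 3 (λ L a b →
                 (L :* (((a :+ b) :* con ½ :- a) :* ((a :+ b) :* con ½ :- a))
               :+ L :* ((b :- (a :+ b) :* con ½) :* (b :- (a :+ b) :* con ½))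
               :+ (L :* ((b :- a) :* con ½)) :* ((b :- a) :* con ½))
               :+ L :* (((b :- a) :* con ½) :* ((b :- a) :* con ½))
               := L :* ((b :- a) :* (b :- a))) refl L a b)))
      where
      m w : ℚ
      m = mid a b
      w = (b - a) * ½
      last : ∣ (f a * (m - a) + f m * (b - m)) - f a * (b - a) ∣ ≤ (L * w) * w
      last = subst (λ z → ∣ z ∣ ≤ (L * w) * w)
        (solve 4 (λ x y a b → (y :- x) :* ((b :- a) :* con ½)
            := (x :* ((a :+ b) :* con ½ :- a) :+ y :* (b :- (a :+ b) :* con ½))
               :- x :* (b :- a))
          refl (f a) (f m) a b)
        (∣∣-* {f m - f a}
          (subst (λ z → ∣ f m - f a ∣ ≤ L * z)
             (trans (cong ∣_∣ (mid-l a b)) (ℚₚ.0≤p⇒∣p∣≡p (0≤-half 0≤w))) (lip m a))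
          (ℚₚ.≤-reflexive (ℚₚ.0≤p⇒∣p∣≡p (0≤-half 0≤w))))

    riemann-refine : ∀ k j a b → 0ℚ ≤ b - a →
      ∣ riemann (k ℕ.+ j) f a b - riemann k f a b ∣ ≤ (L * ((b - a) * (b - a))) * pow k
    riemann-refine zero j a b 0≤w =
      subst (_ ≤_) (sym (ℚₚ.*-identityʳ _)) (riemann-base j a b 0≤w)
    riemann-refine (suc k) j a b 0≤w = subst (_ ≤_)
      (solve 4 (λ L a b p →
          (L :* (((a :+ b) :* con ½ :- a) :* ((a :+ b) :* con ½ :- a))) :* p
       :+ (L :* ((b :- (a :+ b) :* con ½) :* (b :- (a :+ b) :* con ½))) :* p
       := (L :* ((b :- a) :* (b :- a))) :* (con ½ :* p)) refl L a b (pow k))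
      (sum-diff (riemann (k ℕ.+ j) f a (mid a b)) (riemann (k ℕ.+ j) f (mid a b) b)
        (riemann k f a (mid a b)) (riemann k f (mid a b) b)
        (riemann-refine k j a (mid a b) (mid-l≥ a b 0≤w))
        (riemann-refine k j (mid a b) b (mid-r≥ a b 0≤w)))

  ι : ℕ → ℚ
  ι n = ℚ.mkℚ (+ n) 0 (Coprime.sym (1-coprimeTo n))

  ι-suc : ∀ n → ι (suc n) ≡ 1ℚ + ι n
  ι-suc n = trans (sym (ℚₚ.↥p/↧p≡p (ι (suc n))))
    (cong (λ z → (+ 1 ℤ.+ z) ℚ./ 1) (sym (ℤₚ.*-identityʳ (+ n))))

  pow-pos : ∀ n → 0ℚ < pow n
  pow-pos zero    = 0<1
  pow-pos (suc n) = *-pos 0<½ (pow-pos n)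

  pow≤1 : ∀ n → pow n ≤ 1ℚ
  pow≤1 zero    = ℚₚ.≤-refl
  pow≤1 (suc n) = *-mono {½} {1ℚ} {pow n} {1ℚ} 0≤½ (ℚₚ.<⇒≤ 0<1) (ℚ.*≤* (ℤ.+≤+ (ℕ.s≤s ℕ.z≤n))) (pow≤1 n)

  ι-pow : ∀ n → ι n * pow n ≤ 1ℚ
  ι-pow zero    = ℚₚ.≤-trans (ℚₚ.≤-reflexive (ℚₚ.*-zeroˡ 1ℚ)) (ℚₚ.<⇒≤ 0<1)
  ι-pow (suc n) = subst (λ z → z * pow (suc n) ≤ 1ℚ) (sym (ι-suc n))
    (subst (_≤ 1ℚ)
      (solve 2 (λ i p → con ½ :* (p :+ i :* p) := (con 1ℚ :+ i) :* (con ½ :* p))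
         refl (ι n) (pow n))
      (ℚₚ.*-monoˡ-≤-nonNeg ½ (ℚₚ.+-mono-≤ (pow≤1 n) (ι-pow n))))

  1≤ε*den : ∀ ε → 0ℚ < ε → 1ℚ ≤ ε * ι (ℚ.↧ₙ ε)
  1≤ε*den ε@(ℚ.mkℚ (+ suc n) d c) _ = ℚₚ.toℚᵘ-cancel-≤
    (ℚᵘₚ.≤-respʳ-≃ (ℚᵘₚ.≃-sym (ℚₚ.toℚᵘ-homo-* ε (ι (suc d))))
      (ℚᵘ.*≤* (ℤ.+≤+ lem)))
    where
    lem : 1 ℕ.* (suc d ℕ.* 1) ℕ.≤ suc n ℕ.* suc d ℕ.* 1
    lem = subst₂ ℕ._≤_
      (sym (trans (ℕₚ.*-identityˡ _) (ℕₚ.*-identityʳ _)))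
      (sym (ℕₚ.*-identityʳ _))
      (ℕₚ.m≤n*m (suc d) (suc n))
  1≤ε*den (ℚ.mkℚ (+ zero) _ _)  (ℚ.*<* (ℤ.+<+ ()))
  1≤ε*den (ℚ.mkℚ ℤ.-[1+ _ ] _ _) (ℚ.*<* ())

  pow-small : ∀ ε → 0ℚ < ε → ∃ λ N → pow N ≤ ε
  pow-small ε 0<ε = d , ℚₚ.*-cancelˡ-≤-pos (ι d)
      (ℚₚ.≤-trans (ι-pow d) (subst (1ℚ ≤_) (ℚₚ.*-comm ε (ι d)) (1≤ε*den ε 0<ε)))
    where
    d : ℕ
    d = ℚ.↧ₙ ε

  arctan-lip : ∀ n t t' → ∣ arctanApprox n t - arctanApprox n t' ∣ ≤ ∣ t - t' ∣
  arctan-lip n t t' = subst (∣ arctanApprox n t - arctanApprox n t' ∣ ≤_) (ℚₚ.*-identityʳ ∣ t - t' ∣)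
    (riemann-perturb n (arctanIntegrand t) (arctanIntegrand t') ∣ t - t' ∣
      (integrand-lip-t t t') 0ℚ 1ℚ (ℚₚ.<⇒≤ 0<1))

  arctan-refine : ∀ {k m} t → k ℕ.≤ m →
    ∣ arctanApprox m t - arctanApprox k t ∣ ≤ (∣ t ∣ * ∣ t ∣) * pow k
  arctan-refine {k} {m} t k≤m = subst₂
    (λ z c → ∣ arctanApprox z t - arctanApprox k t ∣ ≤ c * pow k)
    (ℕₚ.m+[n∸m]≡n k≤m) (ℚₚ.*-identityʳ (∣ t ∣ * ∣ t ∣))
    (riemann-refine (arctanIntegrand t) (∣ t ∣ * ∣ t ∣) (0≤sq ∣ t ∣)
      (integrand-lip-s t) k (m ℕ.∸ k) 0ℚ 1ℚ (ℚₚ.<⇒≤ 0<1))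

------------------------------------------------------------------------
-- Real numbers: Cauchy sequences of rationals up to _≈_

IsCauchy : (ℕ → ℚ) → Set
IsCauchy s = ∀ ε → 0ℚ ℚ.< ε →
  ∃[ N ] (∀ {m n} → N ℕ.≤ m → N ℕ.≤ n → ℚ.∣ s m ℚ.- s n ∣ ℚ.< ε)

record ℝ : Set where
  constructor mkℝ
  field
    seq    : ℕ → ℚ
    cauchy : IsCauchy seq

open ℝ public

infix 4 _≈_ _<_

_≈_ : ℝ → ℝ → Set
x ≈ y = ∀ ε → 0ℚ ℚ.< ε → ∃[ N ] (∀ {n} → N ℕ.≤ n → ℚ.∣ seq x n ℚ.- seq y n ∣ ℚ.< ε)

_<_ : ℝ → ℝ → Set
x < y = ∃[ δ ] 0ℚ ℚ.< δ × ∃[ N ] (∀ {n} → N ℕ.≤ n → δ ℚ.≤ seq y n ℚ.- seq x n)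

module Cauchyness where

  open import Data.Rational using (_+_; _*_; _-_; -_; ∣_∣; _≤_)
  open +-*-Solver using (solve; _:=_; _:+_; _:*_; _:-_; :-_; con)
  open Estimates

  private
    infix 4 _<ᵣ_
    _<ᵣ_ : ℚ → ℚ → Set
    _<ᵣ_ = ℚ._<_

  const-cauchy : ∀ q → IsCauchy (λ _ → q)
  const-cauchy q ε 0<ε = 0 , λ _ _ → subst (λ z → ∣ z ∣ <ᵣ ε) (sym (ℚₚ.+-inverseʳ q)) 0<ε

  neg-cauchy : ∀ {s} → IsCauchy s → IsCauchy (λ n → - s n)
  neg-cauchy {s} cs ε 0<ε with cs ε 0<ε
  ... | N , h = N , λ {m} {n} p q → subst (_<ᵣ ε)
    (trans (abs-sym (s m) (s n)) (cong ∣_∣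
      (solve 2 (λ a b → b :- a := (:- a) :- (:- b)) refl (s m) (s n)))) (h p q)

  abs-cauchy : ∀ {s} → IsCauchy s → IsCauchy (λ n → ∣ s n ∣)
  abs-cauchy {s} cs ε 0<ε with cs ε 0<ε
  ... | N , h = N , λ {m} {n} p q → ℚₚ.≤-<-trans (abs-abs (s m) (s n)) (h p q)

  +-cauchy : ∀ {s t} → IsCauchy s → IsCauchy t → IsCauchy (λ n → s n + t n)
  +-cauchy {s} {t} cs ct ε 0<ε with cs (ε * ½) (half-pos 0<ε) | ct (ε * ½) (half-pos 0<ε)
  ... | N , h | M , k = N ℕ.⊔ M , λ {m} {n} p q →
    ℚₚ.≤-<-trans (sum-diff (s m) (t m) (s n) (t n) {∣ s m - s n ∣} {∣ t m - t n ∣} ℚₚ.≤-refl ℚₚ.≤-refl)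
      (subst (∣ s m - s n ∣ + ∣ t m - t n ∣ <ᵣ_) (halves ε) (ℚₚ.+-mono-<
        (h (ℕₚ.m⊔n≤o⇒m≤o N M p) (ℕₚ.m⊔n≤o⇒m≤o N M q))
        (k (ℕₚ.m⊔n≤o⇒n≤o N M p) (ℕₚ.m⊔n≤o⇒n≤o N M q))))

  bounded : ∀ {s} → IsCauchy s → ∃[ B ] 0ℚ <ᵣ B × ∃[ N ] (∀ {n} → N ℕ.≤ n → ∣ s n ∣ ≤ B)
  bounded {s} cs with cs 1ℚ 0<1
  ... | N , h = 1ℚ + ∣ s N ∣
    , ℚₚ.<-≤-trans 0<1 (≤-by ∣ s N ∣ (ℚₚ.0≤∣p∣ (s N)) refl)
    , N , λ {n} N≤n → ℚₚ.≤-trans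
      (subst (λ z → ∣ z ∣ ≤ ∣ s n - s N ∣ + ∣ s N ∣)
        (solve 2 (λ a b → (a :- b) :+ b := a) refl (s n) (s N))
        (ℚₚ.∣p+q∣≤∣p∣+∣q∣ (s n - s N) (s N)))
      (ℚₚ.+-monoˡ-≤ ∣ s N ∣ (ℚₚ.<⇒≤ (h N≤n ℕₚ.≤-refl)))

  -- a tolerance δ with B δ = ε
  shrink : ∀ B ε → 0ℚ <ᵣ B → 0ℚ <ᵣ ε → ∃[ δ ] 0ℚ <ᵣ δ × B * δ ≡ ε
  shrink B ε 0<B 0<ε = ε * inv B , *-pos 0<ε (inv-pos 0<B) , trans
    (solve 3 (λ B ε i → B :* (ε :* i) := ε :* (B :* i)) refl B ε (inv B))
    (trans (cong (ε *_) (inv-*ʳ 0<B)) (ℚₚ.*-identityʳ ε))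

  *-diff : ∀ a b c d B C δ η ε → 0ℚ <ᵣ B → 0ℚ <ᵣ C → ∣ a ∣ ≤ B → ∣ d ∣ ≤ C →
           ∣ c - d ∣ <ᵣ δ → ∣ a - b ∣ <ᵣ η → B * δ ≡ ε * ½ → C * η ≡ ε * ½ →
           ∣ a * c - b * d ∣ <ᵣ ε
  *-diff a b c d B C δ η ε 0<B 0<C ha hd hcd hab Bδ Cη =
    subst (λ z → ∣ z ∣ <ᵣ ε)
      (solve 4 (λ a b c d → a :* (c :- d) :+ d :* (a :- b) := a :* c :- b :* d) refl a b c d)
      (ℚₚ.≤-<-trans (ℚₚ.∣p+q∣≤∣p∣+∣q∣ (a * (c - d)) (d * (a - b)))
        (subst (∣ a * (c - d) ∣ + ∣ d * (a - b) ∣ <ᵣ_) (halves ε)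
          (ℚₚ.+-mono-< {∣ a * (c - d) ∣} {ε * ½} {∣ d * (a - b) ∣} {ε * ½} left right)))
    where
    left : ∣ a * (c - d) ∣ <ᵣ ε * ½
    left = ℚₚ.≤-<-trans (∣∣-* {a} {c - d} ha ℚₚ.≤-refl)
      (subst (B * ∣ c - d ∣ <ᵣ_) Bδ (ℚₚ.*-monoʳ-<-pos B {{ℚ.positive 0<B}} hcd))
    right : ∣ d * (a - b) ∣ <ᵣ ε * ½
    right = ℚₚ.≤-<-trans (∣∣-* {d} {a - b} hd ℚₚ.≤-refl)
      (subst (C * ∣ a - b ∣ <ᵣ_) Cη (ℚₚ.*-monoʳ-<-pos C {{ℚ.positive 0<C}} hab))

  *-cauchy : ∀ {s t} → IsCauchy s → IsCauchy t → IsCauchy (λ n → s n * t n)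
  *-cauchy {s} {t} cs ct ε 0<ε =
    let B , 0<B , K , bs = bounded cs
        C , 0<C , L , bt = bounded ct
        δ , 0<δ , Bδ     = shrink B (ε * ½) 0<B (half-pos 0<ε)
        η , 0<η , Cη     = shrink C (ε * ½) 0<C (half-pos 0<ε)
        N , h            = ct δ 0<δ
        M , k            = cs η 0<η
    in (K ℕ.⊔ L) ℕ.⊔ (N ℕ.⊔ M) , λ {m} {n} p q →
      let p₁ = ℕₚ.m⊔n≤o⇒m≤o (K ℕ.⊔ L) (N ℕ.⊔ M) p
          p₂ = ℕₚ.m⊔n≤o⇒n≤o (K ℕ.⊔ L) (N ℕ.⊔ M) p
          q₁ = ℕₚ.m⊔n≤o⇒m≤o (K ℕ.⊔ L) (N ℕ.⊔ M) q
          q₂ = ℕₚ.m⊔n≤o⇒n≤o (K ℕ.⊔ L) (N ℕ.⊔ M) q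
      in *-diff (s m) (s n) (t m) (t n) B C δ η ε 0<B 0<C
           (bs (ℕₚ.m⊔n≤o⇒m≤o K L p₁)) (bt (ℕₚ.m⊔n≤o⇒n≤o K L q₁))
           (h (ℕₚ.m⊔n≤o⇒m≤o N M p₂) (ℕₚ.m⊔n≤o⇒m≤o N M q₂))
           (k (ℕₚ.m⊔n≤o⇒n≤o N M p₂) (ℕₚ.m⊔n≤o⇒n≤o N M q₂))
           Bδ Cη

  inv-cauchy : ∀ {s} → IsCauchy s →
    (∃[ δ ] 0ℚ <ᵣ δ × ∃[ N ] (∀ {n} → N ℕ.≤ n → δ ≤ s n)) → IsCauchy (λ n → inv (s n))
  inv-cauchy {s} cs (δ , 0<δ , N , h) ε 0<ε
    with cs ((ε * ½) * (δ * δ)) (*-pos (half-pos 0<ε) (*-pos 0<δ 0<δ))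
  ... | M , k = N ℕ.⊔ M , λ {m} {n} p q →
    let δ≤m = h (ℕₚ.m⊔n≤o⇒m≤o N M p)
        δ≤n = h (ℕₚ.m⊔n≤o⇒m≤o N M q)
        0≤δ = ℚₚ.<⇒≤ 0<δ
    in ℚₚ.≤-<-trans
      (subst₂ (λ y z → ∣ y - z ∣ ≤ ε * ½)
        (ℚₚ.*-identityˡ (inv (s m))) (ℚₚ.*-identityˡ (inv (s n)))
        (frac-diff 1ℚ 1ℚ (ε * ½) (ℚₚ.<-≤-trans 0<δ δ≤m) (ℚₚ.<-≤-trans 0<δ δ≤n)
          (subst₂ (λ y z → ∣ y - z ∣ ≤ (ε * ½) * (s m * s n))
            (sym (ℚₚ.*-identityˡ (s n))) (sym (ℚₚ.*-identityˡ (s m)))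
            (ℚₚ.≤-trans
              (ℚₚ.<⇒≤ (k (ℕₚ.m⊔n≤o⇒n≤o N M q) (ℕₚ.m⊔n≤o⇒n≤o N M p)))
              (ℚₚ.*-monoˡ-≤-nonNeg (ε * ½) {{ℚ.nonNegative (ℚₚ.<⇒≤ (half-pos 0<ε))}}
                (*-mono {δ} {s m} {δ} {s n} 0≤δ (ℚₚ.≤-trans 0≤δ δ≤n) δ≤m δ≤n))))))
      (subst (ε * ½ <ᵣ_) (halves ε)
        (subst (_<ᵣ ε * ½ + ε * ½) (ℚₚ.+-identityʳ (ε * ½))
          (ℚₚ.+-monoʳ-< (ε * ½) (half-pos 0<ε))))

  chain : ∀ x y z w ε → ∣ x - y ∣ ≤ ε * ½ * ½ → ∣ y - z ∣ <ᵣ ε * ½ → ∣ w - z ∣ ≤ ε * ½ * ½ →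
          ∣ x - w ∣ <ᵣ ε
  chain x y z w ε xy yz wz =
    ℚₚ.≤-<-trans
      (ℚₚ.≤-trans (tri x y w) (ℚₚ.+-monoʳ-≤ ∣ x - y ∣ (tri y z w)))
      (subst (∣ x - y ∣ + (∣ y - z ∣ + ∣ z - w ∣) <ᵣ_)
        (solve 1 (λ ε → ε :* con ½ :* con ½ :+ (ε :* con ½ :+ ε :* con ½ :* con ½) := ε) refl ε)
        (ℚₚ.+-mono-≤-< {∣ x - y ∣} {ε * ½ * ½} xy
          (ℚₚ.+-mono-<-≤ {∣ y - z ∣} {ε * ½} yz
            (subst (_≤ ε * ½ * ½) (abs-sym w z) wz))))

  arctan-near : ∀ t B η ε L m → ∣ t ∣ ≤ B → 0ℚ <ᵣ B → 0ℚ <ᵣ η → pow L ≤ η →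
                B * B * η ≡ ε → L ℕ.≤ m → ∣ arctanApprox m t - arctanApprox L t ∣ ≤ ε
  arctan-near t B η ε L m b 0<B 0<η small Bη L≤m = ℚₚ.≤-trans (arctan-refine {L} {m} t L≤m)
    (subst (∣ t ∣ * ∣ t ∣ * pow L ≤_) Bη
      (*-mono {∣ t ∣ * ∣ t ∣} {B * B} {pow L} {η} (0≤sq ∣ t ∣) (ℚₚ.<⇒≤ 0<η)
        (*-mono {∣ t ∣} {B} {∣ t ∣} {B} (ℚₚ.0≤∣p∣ t) (ℚₚ.<⇒≤ 0<B) b b) small))

  arctan-cauchy : ∀ {s} → IsCauchy s → IsCauchy (λ n → arctanApprox n (s n))
  arctan-cauchy {s} cs ε 0<ε =
    let B , 0<B , K , bs = bounded cs
        η , 0<η , Bη     = shrink (B * B) (ε * ½ * ½) (*-pos 0<B 0<B) (half-pos (half-pos 0<ε))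
        L , small        = pow-small η 0<η
        M , h            = cs (ε * ½) (half-pos 0<ε)
    in (K ℕ.⊔ L) ℕ.⊔ M , λ {m} {n} p q →
      let p₁ = ℕₚ.m⊔n≤o⇒m≤o (K ℕ.⊔ L) M p
          q₁ = ℕₚ.m⊔n≤o⇒m≤o (K ℕ.⊔ L) M q
      in chain (arctanApprox m (s m)) (arctanApprox L (s m)) (arctanApprox L (s n))
               (arctanApprox n (s n)) ε
           (arctan-near (s m) B η (ε * ½ * ½) L m (bs (ℕₚ.m⊔n≤o⇒m≤o K L p₁))
             0<B 0<η small Bη (ℕₚ.m⊔n≤o⇒n≤o K L p₁))
           (ℚₚ.≤-<-trans (arctan-lip L (s m) (s n))
             (h (ℕₚ.m⊔n≤o⇒n≤o (K ℕ.⊔ L) M p) (ℕₚ.m⊔n≤o⇒n≤o (K ℕ.⊔ L) M q)))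
           (arctan-near (s n) B η (ε * ½ * ½) L n (bs (ℕₚ.m⊔n≤o⇒m≤o K L q₁))
             0<B 0<η small Bη (ℕₚ.m⊔n≤o⇒n≤o K L q₁))

infix  8 -_
infixl 7 _*_
infixl 6 _+_ _-_

fromℚ : ℚ → ℝ
fromℚ q = mkℝ (λ _ → q) (Cauchyness.const-cauchy q)

0ℝ 1ℝ : ℝ
0ℝ = fromℚ 0ℚ
1ℝ = fromℚ 1ℚ

_+_ _*_ : ℝ → ℝ → ℝ
x + y = mkℝ (λ n → seq x n ℚ.+ seq y n) (Cauchyness.+-cauchy {seq x} {seq y} (cauchy x) (cauchy y))
x * y = mkℝ (λ n → seq x n ℚ.* seq y n) (Cauchyness.*-cauchy {seq x} {seq y} (cauchy x) (cauchy y))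

-_ : ℝ → ℝ
-_ x = mkℝ (λ n → ℚ.- seq x n) (Cauchyness.neg-cauchy {seq x} (cauchy x))

_-_ : ℝ → ℝ → ℝ
x - y = x + (- y)

∣_∣ : ℝ → ℝ
∣ x ∣ = mkℝ (λ n → ℚ.∣ seq x n ∣) (Cauchyness.abs-cauchy {seq x} (cauchy x))

recip : (x : ℝ) → 0ℝ < x → ℝ
recip x (δ , 0<δ , N , h) = mkℝ (λ n → inv (seq x n))
  (Cauchyness.inv-cauchy {seq x} (cauchy x)
    (δ , 0<δ , N , λ {n} N≤n → subst (δ ℚ.≤_) (ℚₚ.+-identityʳ (seq x n)) (h N≤n)))

arctan : ℝ → ℝ
arctan x = mkℝ (λ n → arctanApprox n (seq x n)) (Cauchyness.arctan-cauchy {seq x} (cauchy x))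

π/2 π : ℝ
π/2 = arctan 1ℝ + arctan 1ℝ
π   = π/2 + π/2

arccot : ℝ → ℝ
arccot t = π/2 - arctan t

------------------------------------------------------------------------
-- Plane geometry

Point : Set
Point = ℝ × ℝ

infix 4 _≈ₚ_

_≈ₚ_ : Point → Point → Set
(x₁ , x₂) ≈ₚ (y₁ , y₂) = x₁ ≈ y₁ × x₂ ≈ y₂

_-ₚ_ : Point → Point → Point
(x₁ , x₂) -ₚ (y₁ , y₂) = x₁ - y₁ , x₂ - y₂

dot cross : Point → Point → ℝ
dot   (u₁ , u₂) (v₁ , v₂) = u₁ * v₁ + u₂ * v₂
cross (u₁ , u₂) (v₁ , v₂) = u₁ * v₂ - u₂ * v₁

-- With u = x − y and v = z − y one has dot u v = |u||v| cos θ and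
-- |cross u v| = |u||v| sin θ for the angle θ = ∠xyz in [0 , π], so that
-- θ = arccot (dot u v / |cross u v|) unless x, y, z are collinear.
data IsAngle (x y z : Point) (θ : ℝ) : Set where
  proper   : (c>0 : 0ℝ < ∣ cross (x -ₚ y) (z -ₚ y) ∣) →
             θ ≈ arccot (dot (x -ₚ y) (z -ₚ y) * recip ∣ cross (x -ₚ y) (z -ₚ y) ∣ c>0) →
             IsAngle x y z θ
  null     : cross (x -ₚ y) (z -ₚ y) ≈ 0ℝ → 0ℝ < dot (x -ₚ y) (z -ₚ y) →
             θ ≈ 0ℝ → IsAngle x y z θ
  straight : cross (x -ₚ y) (z -ₚ y) ≈ 0ℝ → dot (x -ₚ y) (z -ₚ y) < 0ℝ →
             θ ≈ π → IsAngle x y z θ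

-- The line a x + b y = c.
record Line : Set where
  field
    a b c      : ℝ
    nontrivial : ¬ (a ≈ 0ℝ × b ≈ 0ℝ)

_∈ₗ_ : Point → Line → Set
(x , y) ∈ₗ ℓ = Line.a ℓ * x + Line.b ℓ * y ≈ Line.c ℓ

------------------------------------------------------------------------
-- The number of distinct angles

-- Sets P₁, …, P_k with |Pᵢ| = rᵢ, enumerated as point i : Fin rᵢ → ℝ².
-- Injectivity on all pairs (i , a) says both that the enumerations are
-- free of repetitions and that the sets are pairwise disjoint.
record Configuration {k : ℕ} (r : Vec ℕ k) : Set where
  field
    point        : (i : Fin k) → Fin (lookup r i) → Point
    distinct     : Injective _≡_ _≈ₚ_ (uncurry point)
    notCollinear : ¬ (Σ[ ℓ ∈ Line ] (∀ i a → point i a ∈ₗ ℓ))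

AngleOf : ∀ {k} {r : Vec ℕ k} → Configuration r → ℝ → Set
AngleOf {k} {r} C θ =
  ∃[ i ] ∃[ j ] ∃[ l ] i ≢ j × j ≢ l × i ≢ l ×
  (∃[ a ] ∃[ b ] ∃[ c ] IsAngle (point i a) (point j b) (point l c) θ) ×
  0ℝ < θ × θ < π
  where open Configuration C

HasDistinct : (ℝ → Set) → ℕ → Set
HasDistinct S m = Σ[ f ∈ (Fin m → ℝ) ] (∀ i → S (f i)) × Injective _≡_ _≈_ f

-- S has exactly m elements up to _≈_.
HasSize : (ℝ → Set) → ℕ → Set
HasSize S m = HasDistinct S m × ¬ HasDistinct S (suc m)

-- m = A(r₁, …, r_k), a minimum over all configurations.  A is a relation
-- because the minimum cannot be computed constructively.
IsA : ∀ {k} → Vec ℕ k → ℕ → Set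
IsA r m = (Σ[ C ∈ Configuration r ] HasSize (AngleOf C) m) ×
          (∀ (C : Configuration r) m' → HasSize (AngleOf C) m' → m ℕ.≤ m')

{-# OPTIONS --safe #-}
-- Put one point of P₁ at the apex (0 , 1) and every other point on the x-axis.
-- Two points of P₁ never occur in one angle, so a nonzero angle is formed by the
-- apex and two axis points outside P₁.  There are s = n − r₁ of the latter; put
-- them at cot α, cot 2α, …, cot sα.  Then the angles at the apex are dα with
-- 1 ≤ d < s, and the angle at the point cot iα is iα if the other axis point is to
-- its left (so i < s) and π − iα if it is to its right (so i > 1): altogether at
-- most 2(s − 1) values.  A large rational cot α makes all cot iα rational and
-- positive, and angles only need to be compared through their cotangents.
module Submission where

open import Defs using (IsA)
open import Data.Nat.Base using (ℕ; suc; _≤_; _≥_; _*_; _∸_)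
open import Data.Product.Base using (∃; _×_)
open import Data.Vec.Base using (Vec; head; sum)
open import Data.Vec.Relation.Unary.All using (All)
open import Data.Vec.Relation.Unary.Linked using (Linked)
open import Relation.Nullary using (¬_)

open import Defs hiding (IsA; _+_; _*_; _-_; -_; ∣_∣; _<_)
import Defs as ℝ
open import Data.Fin.Base as F using (Fin; toℕ; fromℕ<; combine; remQuot; splitAt; _↑ˡ_; _↑ʳ_)
import Data.Fin.Properties as Fₚ
import Data.Integer.Base as ℤ
import Data.Integer.Properties as ℤₚ
open import Data.Nat.Base as ℕ using (zero; z≤n; s≤s)
import Data.Nat.Induction as ℕInd
import Data.Nat.Properties as ℕₚ
open import Data.Product.Base using (Σ-syntax; ∃-syntax; _,_; proj₁; proj₂; uncurry)
open import Data.Rational as ℚ using (ℚ; 0ℚ; 1ℚ; ½)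
import Data.Rational.Properties as ℚₚ
open import Data.Rational.Solver using (module +-*-Solver)
open import Data.Sum.Base using (inj₁; inj₂)
open import Data.Vec.Base using ([]; _∷_; lookup)
open import Data.Vec.Relation.Unary.All using ([]; _∷_)
open import Function.Base using (_∘_)
open import Relation.Binary.Definitions using (tri<; tri≈; tri>)
open import Relation.Binary.PropositionalEquality
  using (_≡_; _≢_; refl; sym; trans; cong; cong₂; subst; module ≡-Reasoning)
open import Relation.Nullary using (yes; no; contradiction)
open import Relation.Nullary.Decidable using (decidable-stable)
open +-*-Solver using (solve; _:=_; _:+_; _:*_; _:-_; :-_; con)
open Estimates

-- Null sequences and equality of reals

-- `x ≈ y` unfolds to `Null` of the difference of the two sequences, so the closure properties below
-- act directly on equalities of reals.
Null : (ℕ → ℚ) → Set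
Null u = ∀ ε → 0ℚ ℚ.< ε → ∃[ N ] (∀ {n} → N ≤ n → ℚ.∣ u n ∣ ℚ.< ε)

Null-resp : ∀ {u v} → (∀ n → u n ≡ v n) → Null u → Null v
Null-resp e h ε 0<ε with h ε 0<ε
... | N , k = N , λ {n} N≤n → subst (λ z → ℚ.∣ z ∣ ℚ.< ε) (e n) (k N≤n)

Null-+ : ∀ {u v} → Null u → Null v → Null (λ n → u n ℚ.+ v n)
Null-+ {u} {v} hu hv ε 0<ε with hu (ε ℚ.* ½) (half-pos 0<ε) | hv (ε ℚ.* ½) (half-pos 0<ε)
... | N , h | K , k = N ℕ.⊔ K , λ {n} p → ℚₚ.≤-<-trans (ℚₚ.∣p+q∣≤∣p∣+∣q∣ (u n) (v n))
  (subst (ℚ.∣ u n ∣ ℚ.+ ℚ.∣ v n ∣ ℚ.<_) (halves ε)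
    (ℚₚ.+-mono-< {ℚ.∣ u n ∣} {ε ℚ.* ½} {ℚ.∣ v n ∣} {ε ℚ.* ½}
      (h (ℕₚ.m⊔n≤o⇒m≤o N K p)) (k (ℕₚ.m⊔n≤o⇒n≤o N K p))))

Null-* : ∀ {u} q → Null u → Null (λ n → q ℚ.* u n)
Null-* {u} q h ε 0<ε =
  -- The summand `1ℚ` keeps the bound positive when `q` is zero, so that `shrink` can divide by it.
  let B          = 1ℚ ℚ.+ ℚ.∣ q ∣
      0<B        = ℚₚ.<-≤-trans 0<1 (≤-by ℚ.∣ q ∣ (ℚₚ.0≤∣p∣ q) refl)
      q≤B        = ≤-by 1ℚ (ℚₚ.<⇒≤ 0<1) (ℚₚ.+-comm ℚ.∣ q ∣ 1ℚ)
      δ , 0<δ , Bδ = Cauchyness.shrink B ε 0<B 0<ε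
      N , k      = h δ 0<δ
  in N , λ {n} p → ℚₚ.≤-<-trans (∣∣-* {q} {u n} q≤B ℚₚ.≤-refl)
       (subst (B ℚ.* ℚ.∣ u n ∣ ℚ.<_) Bδ (ℚₚ.*-monoʳ-<-pos B {{ℚ.positive 0<B}} (k p)))

≡⇒≈ : ∀ x y → (∀ n → seq x n ≡ seq y n) → x ≈ y
≡⇒≈ x y e ε 0<ε = 0 , λ {n} _ → subst (λ z → ℚ.∣ z ∣ ℚ.< ε)
  (sym (trans (cong (ℚ._- seq y n) (e n)) (ℚₚ.+-inverseʳ (seq y n)))) 0<ε

≈-sym : ∀ x y → x ≈ y → y ≈ x
≈-sym x y h = Null-resp
  (λ n → solve 2 (λ a b → con (ℚ.- 1ℚ) :* (a :- b) := b :- a) refl (seq x n) (seq y n))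
  (Null-* {λ n → seq x n ℚ.- seq y n} (ℚ.- 1ℚ) h)

≈-trans : ∀ x y z → x ≈ y → y ≈ z → x ≈ z
≈-trans x y z h k = Null-resp
  (λ n → solve 3 (λ a b c → (a :- b) :+ (b :- c) := a :- c) refl (seq x n) (seq y n) (seq z n))
  (Null-+ {λ n → seq x n ℚ.- seq y n} {λ n → seq y n ℚ.- seq z n} h k)

<⇒≉ : ∀ x y → x ℝ.< y → ¬ (y ≈ x)
<⇒≉ x y (δ , 0<δ , N , h) y≈x with y≈x δ 0<δ
... | K , k = ℚₚ.<-irrefl refl (ℚₚ.≤-<-trans (ℚₚ.≤-trans (h (ℕₚ.m≤m⊔n N K)) (≤abs _)) (k (ℕₚ.m≤n⊔m N K)))

fromℚ-injective : ∀ p q → fromℚ p ≈ fromℚ q → p ≡ q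
fromℚ-injective p q h with p ℚₚ.≟ q
... | yes p≡q = p≡q
... | no  p≢q =
  -- With this tolerance the constant difference would be smaller than its own absolute value.
  let N , k = h ℚ.∣ p ℚ.- q ∣ 0<∣p-q∣ in contradiction (k ℕₚ.≤-refl) (ℚₚ.<-irrefl refl)
  where
  0<∣p-q∣ : 0ℚ ℚ.< ℚ.∣ p ℚ.- q ∣
  0<∣p-q∣ = ℚₚ.≰⇒> λ le → p≢q (trans
    (solve 2 (λ p q → p := (p :- q) :+ q) refl p q)
    (trans (cong (ℚ._+ q) (ℚₚ.∣p∣≡0⇒p≡0 (p ℚ.- q) (ℚₚ.≤-antisym le (ℚₚ.0≤∣p∣ (p ℚ.- q)))))
           (ℚₚ.+-identityˡ q)))

-- Rational points

ℚPoint : Set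
ℚPoint = ℚ × ℚ

embed : ℚPoint → Point
embed (p , q) = fromℚ p , fromℚ q

embed-injective : ∀ x y → embed x ≈ₚ embed y → x ≡ y
embed-injective (x₁ , x₂) (y₁ , y₂) (h₁ , h₂) =
  cong₂ _,_ (fromℚ-injective x₁ y₁ h₁) (fromℚ-injective x₂ y₂ h₂)

dotAt crossAt cotAt : ℚPoint → ℚPoint → ℚPoint → ℚ
dotAt (x₁ , x₂) (y₁ , y₂) (z₁ , z₂) =
  (x₁ ℚ.- y₁) ℚ.* (z₁ ℚ.- y₁) ℚ.+ (x₂ ℚ.- y₂) ℚ.* (z₂ ℚ.- y₂)
crossAt (x₁ , x₂) (y₁ , y₂) (z₁ , z₂) =
  (x₁ ℚ.- y₁) ℚ.* (z₂ ℚ.- y₂) ℚ.- (x₂ ℚ.- y₂) ℚ.* (z₁ ℚ.- y₁)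
cotAt x y z = dotAt x y z ℚ.* inv ℚ.∣ crossAt x y z ∣

-- The bounds `0 < θ < π` exclude the `null` and `straight` cases. In the `proper` case all
-- coordinates are constant sequences, so the real cotangent is termwise the rational `cotAt`.
angle-rational : ∀ x y z {θ} → IsAngle (embed x) (embed y) (embed z) θ →
  0ℝ ℝ.< θ → θ ℝ.< π → crossAt x y z ≢ 0ℚ × θ ≈ arccot (fromℚ (cotAt x y z))
angle-rational x y z {θ} (proper c>0@(δ , 0<δ , N , h) e) _ _ =
  nonzero , ≈-trans θ w (arccot (fromℚ (cotAt x y z))) e
    (≡⇒≈ w (arccot (fromℚ (cotAt x y z))) (λ n → refl))
  where
  u v : Point
  u = embed x -ₚ embed y
  v = embed z -ₚ embed y
  w : ℝ
  w = arccot (dot u v ℝ.* recip ℝ.∣ cross u v ∣ c>0)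
  nonzero : crossAt x y z ≢ 0ℚ
  nonzero X≡0 = ℚₚ.<-irrefl {0ℚ} refl (ℚₚ.<-≤-trans {0ℚ} {δ} 0<δ δ≤0)
    where
    X : ℚ
    X = crossAt x y z
    ∣X∣≡0 : ℚ.∣ X ∣ ≡ 0ℚ
    ∣X∣≡0 = cong ℚ.∣_∣ X≡0
    δ≤0 : δ ℚ.≤ 0ℚ
    δ≤0 = subst (δ ℚ.≤_) (trans (ℚₚ.+-identityʳ ℚ.∣ X ∣) ∣X∣≡0) (h {N} ℕₚ.≤-refl)
angle-rational x y z {θ} (null _ _ θ≈0)     0<θ _   = contradiction θ≈0 (<⇒≉ 0ℝ θ 0<θ)
angle-rational x y z {θ} (straight _ _ θ≈π) _   θ<π = contradiction (≈-sym θ π θ≈π) (<⇒≉ θ π θ<π)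

-- Reduces the evaluation of a cotangent to two polynomial identities; positivity of `K` makes `inv`
-- a true reciprocal.
cotAt-≡ : ∀ x y z v K → 0ℚ ℚ.< K → ℚ.∣ crossAt x y z ∣ ≡ K → dotAt x y z ≡ v ℚ.* K → cotAt x y z ≡ v
cotAt-≡ x y z v K 0<K X≡K D≡vK = begin
  dotAt x y z ℚ.* inv ℚ.∣ crossAt x y z ∣ ≡⟨ cong₂ (λ D X → D ℚ.* inv X) D≡vK X≡K ⟩
  v ℚ.* K ℚ.* inv K                       ≡⟨ ℚₚ.*-assoc v K (inv K) ⟩
  v ℚ.* (K ℚ.* inv K)                     ≡⟨ cong (v ℚ.*_) (inv-*ʳ 0<K) ⟩
  v ℚ.* 1ℚ                                ≡⟨ ℚₚ.*-identityʳ v ⟩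
  v                                       ∎
  where open ≡-Reasoning

crossAt-swap : ∀ x y z → crossAt x y z ≡ ℚ.- crossAt z y x
crossAt-swap (x₁ , x₂) (y₁ , y₂) (z₁ , z₂) = solve 6 (λ x₁ x₂ y₁ y₂ z₁ z₂ →
    (x₁ :- y₁) :* (z₂ :- y₂) :- (x₂ :- y₂) :* (z₁ :- y₁)
 := :- ((z₁ :- y₁) :* (x₂ :- y₂) :- (z₂ :- y₂) :* (x₁ :- y₁))) refl x₁ x₂ y₁ y₂ z₁ z₂

cotAt-sym : ∀ x y z → cotAt x y z ≡ cotAt z y x
cotAt-sym x@(x₁ , x₂) y@(y₁ , y₂) z@(z₁ , z₂) = cong₂ (λ D X → D ℚ.* inv X)
  (solve 6 (λ x₁ x₂ y₁ y₂ z₁ z₂ →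
      (x₁ :- y₁) :* (z₁ :- y₁) :+ (x₂ :- y₂) :* (z₂ :- y₂)
   := (z₁ :- y₁) :* (x₁ :- y₁) :+ (z₂ :- y₂) :* (x₂ :- y₂)) refl x₁ x₂ y₁ y₂ z₁ z₂)
  (trans (cong ℚ.∣_∣ (crossAt-swap x y z)) (ℚₚ.∣-p∣≡∣p∣ (crossAt z y x)))

-- Angles formed by the apex and two axis points

apex : ℚPoint
apex = 0ℚ , 1ℚ

axis : ℚ → ℚPoint
axis t = t , 0ℚ

axis-cross : ∀ t u v → crossAt (axis t) (axis u) (axis v) ≡ 0ℚ
axis-cross = solve 3 (λ t u v → (t :- u) :* (con 0ℚ :- con 0ℚ)
  :- (con 0ℚ :- con 0ℚ) :* (v :- u) := con 0ℚ) refl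

0<- : ∀ {p q} → p ℚ.< q → 0ℚ ℚ.< q ℚ.- p
0<- {p} {q} p<q = subst (ℚ._< q ℚ.- p) (ℚₚ.+-inverseʳ p) (ℚₚ.+-monoˡ-< (ℚ.- p) p<q)

0≤- : ∀ {p q} → p ℚ.≤ q → 0ℚ ℚ.≤ q ℚ.- p
0≤- {p} {q} p≤q = subst (ℚ._≤ q ℚ.- p) (ℚₚ.+-inverseʳ p) (ℚₚ.+-monoˡ-≤ (ℚ.- p) p≤q)

∣pos∣ : ∀ {p} → 0ℚ ℚ.< p → ℚ.∣ p ∣ ≡ p
∣pos∣ = ℚₚ.0≤p⇒∣p∣≡p ∘ ℚₚ.<⇒≤

-- For `t = cot a` and `u = cot b` the hypothesis is the subtraction formula with `v = cot (b - a)`: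
-- the segments from the apex descend at angles a and b to the axis.
cot-apex : ∀ t u v → u ℚ.< t → 1ℚ ℚ.+ t ℚ.* u ≡ v ℚ.* (t ℚ.- u) →
           cotAt (axis t) apex (axis u) ≡ v
cot-apex t u v u<t e = cotAt-≡ (axis t) apex (axis u) v (t ℚ.- u) (0<- u<t)
  (trans (cong ℚ.∣_∣ (solve 2 (λ t u → (t :- con 0ℚ) :* (con 0ℚ :- con 1ℚ)
      :- (con 0ℚ :- con 1ℚ) :* (u :- con 0ℚ) := :- (t :- u)) refl t u))
    (trans (ℚₚ.∣-p∣≡∣p∣ (t ℚ.- u)) (∣pos∣ (0<- u<t))))
  (trans (solve 2 (λ t u → (t :- con 0ℚ) :* (u :- con 0ℚ)
      :+ (con 0ℚ :- con 1ℚ) :* (con 0ℚ :- con 1ℚ) := con 1ℚ :+ t :* u) refl t u) e)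

-- If `t = cot a`, the segment to the apex makes the angle π - a with the positive axis direction:
-- seen from `axis t`, points to the left give a and, in `cot-right`, points to the right give π -
-- a.
cot-left : ∀ t u → u ℚ.< t → cotAt apex (axis t) (axis u) ≡ t
cot-left t u u<t = cotAt-≡ apex (axis t) (axis u) t (t ℚ.- u) (0<- u<t)
  (trans (cong ℚ.∣_∣ (solve 2 (λ t u → (con 0ℚ :- t) :* (con 0ℚ :- con 0ℚ)
      :- (con 1ℚ :- con 0ℚ) :* (u :- t) := t :- u) refl t u)) (∣pos∣ (0<- u<t)))
  (solve 2 (λ t u → (con 0ℚ :- t) :* (u :- t) :+ (con 1ℚ :- con 0ℚ) :* (con 0ℚ :- con 0ℚ)
      := t :* (t :- u)) refl t u)

cot-right : ∀ t u → t ℚ.< u → cotAt apex (axis t) (axis u) ≡ ℚ.- t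
cot-right t u t<u = cotAt-≡ apex (axis t) (axis u) (ℚ.- t) (u ℚ.- t) (0<- t<u)
  (trans (cong ℚ.∣_∣ (solve 2 (λ t u → (con 0ℚ :- t) :* (con 0ℚ :- con 0ℚ)
      :- (con 1ℚ :- con 0ℚ) :* (u :- t) := :- (u :- t)) refl t u))
    (trans (ℚₚ.∣-p∣≡∣p∣ (u ℚ.- t)) (∣pos∣ (0<- t<u))))
  (solve 2 (λ t u → (con 0ℚ :- t) :* (u :- t) :+ (con 1ℚ :- con 0ℚ) :* (con 0ℚ :- con 0ℚ)
      := (:- t) :* (u :- t)) refl t u)

-- Subtracting the equations at the two axis points and dividing by `t - u` gives `a ≈ 0`; the
-- equations at the apex and at `axis t` then give `b ≈ 0`.
apex-noncollinear : ∀ (ℓ : Line) {t u} → t ≢ u → embed apex ∈ₗ ℓ →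
                    embed (axis t) ∈ₗ ℓ → ¬ (embed (axis u) ∈ₗ ℓ)
apex-noncollinear ℓ {t} {u} t≢u hA ht hu = nontrivial (a≈0 , b≈0)
  where
  open Line ℓ
  instance
    t-u≢0 : ℚ.NonZero (t ℚ.- u)
    t-u≢0 = ℚ.≢-nonZero {t ℚ.- u} λ e → t≢u (trans (solve 2 (λ t u → t := (t :- u) :+ u) refl t u)
      (trans (cong (ℚ._+ u) e) (ℚₚ.+-identityˡ u)))
  w : ℚ
  w = ℚ.1/ (t ℚ.- u)
  residue : ℚPoint → ℕ → ℚ
  residue (p , q) n = (seq a n ℚ.* p ℚ.+ seq b n ℚ.* q) ℚ.- seq c n
  a≈0 : a ≈ 0ℝ
  a≈0 = Null-resp
    (λ n → trans
      (solve 6 (λ w t u a b c →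
          w :* (((a :* t :+ b :* con 0ℚ) :- c) :+ con (ℚ.- 1ℚ) :* ((a :* u :+ b :* con 0ℚ) :- c))
          := (w :* (t :- u)) :* a) refl w t u (seq a n) (seq b n) (seq c n))
      (trans (cong (ℚ._* seq a n) (ℚₚ.*-inverseˡ (t ℚ.- u)))
        (solve 1 (λ a → con 1ℚ :* a := a :- con 0ℚ) refl (seq a n))))
    (Null-* w (Null-+ {residue (axis t)} ht (Null-* {residue (axis u)} (ℚ.- 1ℚ) hu)))
  b≈0 : b ≈ 0ℝ
  b≈0 = Null-resp
    (λ n → solve 4 (λ t a b c →
        ((a :* con 0ℚ :+ b :* con 1ℚ) :- c)
          :+ (t :* (a :- con 0ℚ) :+ con (ℚ.- 1ℚ) :* ((a :* t :+ b :* con 0ℚ) :- c))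
        := b :- con 0ℚ) refl t (seq a n) (seq b n) (seq c n))
    (Null-+ {residue apex} hA
      (Null-+ {λ n → t ℚ.* (seq a n ℚ.- 0ℚ)} (Null-* {λ n → seq a n ℚ.- 0ℚ} t a≈0)
        (Null-* {residue (axis t)} (ℚ.- 1ℚ) ht)))

-- Cotangents of multiples of a small angle

ι-mono : ∀ {m n} → m ≤ n → ι m ℚ.≤ ι n
ι-mono m≤n = ℚ.*≤* (ℤₚ.*-monoʳ-≤-nonNeg (ℤ.+ 1) (ℤ.+≤+ m≤n))

ι-pos : ∀ n → 0ℚ ℚ.< ι (suc n)
ι-pos n = ℚₚ.<-≤-trans 0<1 (ι-mono {1} {suc n} (s≤s z≤n))

*-cancel-pos : ∀ k x y → 0ℚ ℚ.< k → k ℚ.* x ≡ k ℚ.* y → x ≡ y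
*-cancel-pos k x y 0<k e = ℚₚ.≤-antisym
  (ℚₚ.*-cancelˡ-≤-pos k {{ℚ.positive 0<k}} (ℚₚ.≤-reflexive e))
  (ℚₚ.*-cancelˡ-≤-pos k {{ℚ.positive 0<k}} (ℚₚ.≤-reflexive (sym e)))

-- The induction step for the addition formula: with A = cot a, B = cot b,
-- M = cot α, A′ = cot (a + α), B′ = cot (b + α), it identifies
-- C = cot (a + (b + α)) as cot ((a + α) + b).
module _ where
  open import Data.Rational using (_+_; _-_; -_; _<_) renaming (_*_ to _∙_)

  cot-shift : ∀ A A′ B B′ C M → 0ℚ < M → 0ℚ < A + B′ →
    A′ ∙ (M + A) ≡ M ∙ A - 1ℚ → B′ ∙ (M + B) ≡ M ∙ B - 1ℚ →
    C ∙ (A + B′) ≡ A ∙ B′ - 1ℚ → C ∙ (A′ + B) ≡ A′ ∙ B - 1ℚ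
  cot-shift A A′ B B′ C M 0<M 0<A+B′ eA eB eC =
    *-cancel-pos (A + B′) _ _ 0<A+B′ (begin
      (A + B′) ∙ (C ∙ (A′ + B))
        ≡⟨ solve 4 (λ A B′ C D → (A :+ B′) :* (C :* D) := (C :* (A :+ B′)) :* D) refl A B′ C (A′ + B) ⟩
      (C ∙ (A + B′)) ∙ (A′ + B)
        ≡⟨ cong (_∙ (A′ + B)) eC ⟩
      -- The excess over the wanted product is a difference of two terms that `same` shows to be
      -- equal.
      (A ∙ B′ - 1ℚ) ∙ (A′ + B)
        ≡⟨ solve 4 (λ A A′ B B′ → (A :* B′ :- con 1ℚ) :* (A′ :+ B)
             := (A :+ B′) :* (A′ :* B :- con 1ℚ)
                :+ ((B′ :- B) :* (con 1ℚ :+ A :* A′) :- (A′ :- A) :* (con 1ℚ :+ B :* B′)))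
             refl A A′ B B′ ⟩
      (A + B′) ∙ (A′ ∙ B - 1ℚ) + ((B′ - B) ∙ (1ℚ + A ∙ A′) - (A′ - A) ∙ (1ℚ + B ∙ B′))
        ≡⟨ cong (λ z → (A + B′) ∙ (A′ ∙ B - 1ℚ) + (z - (A′ - A) ∙ (1ℚ + B ∙ B′))) (sym same) ⟩
      (A + B′) ∙ (A′ ∙ B - 1ℚ) + ((A′ - A) ∙ (1ℚ + B ∙ B′) - (A′ - A) ∙ (1ℚ + B ∙ B′))
        ≡⟨ solve 2 (λ x y → x :+ (y :- y) := x) refl _ ((A′ - A) ∙ (1ℚ + B ∙ B′)) ⟩
      (A + B′) ∙ (A′ ∙ B - 1ℚ) ∎)
    where
    open ≡-Reasoning
    -- The subtraction formula for `M = cot α`. Multiplied by `M`, both sides of `same` thereby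
    -- become `- (1 + A A′)(1 + B B′)`.
    diff : ∀ A A′ → A′ ∙ (M + A) ≡ M ∙ A - 1ℚ → M ∙ (A′ - A) ≡ - (1ℚ + A ∙ A′)
    diff A A′ e = begin
      M ∙ (A′ - A)                              ≡⟨ solve 3 (λ A A′ M → M :* (A′ :- A) := A′ :* (M :+ A) :- (M :* A :+ A :* A′)) refl A A′ M ⟩
      A′ ∙ (M + A) - (M ∙ A + A ∙ A′)           ≡⟨ cong (_- (M ∙ A + A ∙ A′)) e ⟩
      (M ∙ A - 1ℚ) - (M ∙ A + A ∙ A′)           ≡⟨ solve 3 (λ A A′ M → (M :* A :- con 1ℚ) :- (M :* A :+ A :* A′) := :- (con 1ℚ :+ A :* A′)) refl A A′ M ⟩
      - (1ℚ + A ∙ A′)                           ∎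
    same : (A′ - A) ∙ (1ℚ + B ∙ B′) ≡ (B′ - B) ∙ (1ℚ + A ∙ A′)
    same = *-cancel-pos M _ _ 0<M (begin
      M ∙ ((A′ - A) ∙ (1ℚ + B ∙ B′))       ≡⟨ sym (ℚₚ.*-assoc M (A′ - A) (1ℚ + B ∙ B′)) ⟩
      (M ∙ (A′ - A)) ∙ (1ℚ + B ∙ B′)       ≡⟨ cong (_∙ (1ℚ + B ∙ B′)) (diff A A′ eA) ⟩
      (- (1ℚ + A ∙ A′)) ∙ (1ℚ + B ∙ B′)    ≡⟨ solve 2 (λ x y → (:- x) :* y := (:- y) :* x) refl (1ℚ + A ∙ A′) (1ℚ + B ∙ B′) ⟩
      (- (1ℚ + B ∙ B′)) ∙ (1ℚ + A ∙ A′)    ≡⟨ cong (_∙ (1ℚ + A ∙ A′)) (sym (diff B B′ eB)) ⟩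
      (M ∙ (B′ - B)) ∙ (1ℚ + A ∙ A′)       ≡⟨ ℚₚ.*-assoc M (B′ - B) (1ℚ + A ∙ A′) ⟩
      M ∙ ((B′ - B) ∙ (1ℚ + A ∙ A′))       ∎)

-- The fan has `m + 1` axis points, indexed by `p ≤ m`; index `p` belongs to the multiple
-- `(p + 1)α`. The choice `M = 2 (m + 1)` keeps all these multiples at most π/4.
module Fan (m : ℕ) where

  S M : ℚ
  S = ι (suc m)
  M = S ℚ.+ S

  0<M : 0ℚ ℚ.< M
  0<M = ℚₚ.+-mono-< (ι-pos m) (ι-pos m)

  -- cot p = cot ((p + 1)α), where cot α = M
  cot : ℕ → ℚ
  cot zero    = M
  cot (suc p) = (M ℚ.* cot p ℚ.- 1ℚ) ℚ.* inv (M ℚ.+ cot p)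

  ≤⇒1≤cot : ∀ p → p ≤ m → S ℚ.≤ ι (suc p) ℚ.* cot p → 1ℚ ℚ.≤ cot p
  ≤⇒1≤cot p p≤m h = ℚₚ.*-cancelˡ-≤-pos (ι (suc p)) {{ℚ.positive (ι-pos p)}}
    (ℚₚ.≤-trans (ℚₚ.≤-reflexive (ℚₚ.*-identityʳ (ι (suc p)))) (ℚₚ.≤-trans (ι-mono (s≤s p≤m)) h))

  0<M+ : ∀ {c} → 1ℚ ℚ.≤ c → 0ℚ ℚ.< M ℚ.+ c
  0<M+ 1≤c = ℚₚ.+-mono-< 0<M (ℚₚ.<-≤-trans 0<1 1≤c)

  -- tan ((p + 1)α) ≤ (p + 1) / (m + 1): the slack between tan α = 1 / (2m + 2)
  -- and 1 / (m + 1) absorbs the growth of the tangent's slope.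
  cot-large : ∀ p → p ≤ m → S ℚ.≤ ι (suc p) ℚ.* cot p
  cot-large zero    _   = ≤-by S (ℚₚ.<⇒≤ (ι-pos m)) (sym (ℚₚ.*-identityˡ M))
  cot-large (suc p) p<m = ℚₚ.*-cancelʳ-≤-pos (M ℚ.+ c) {{ℚ.positive 0<M+c}}
    (ℚₚ.≤-trans
      -- The difference of the two sides, split into terms that are nonnegative by the induction
      -- hypothesis, by `1 ≤ c`, and by `p + 2 ≤ m + 1`.
      (≤-by ((S ℚ.+ S) ℚ.* (P ℚ.* c ℚ.- S) ℚ.+ S ℚ.* (c ℚ.- 1ℚ) ℚ.+ (S ℚ.- (1ℚ ℚ.+ P)))
        (0≤+ (0≤+ (*-nonneg (ℚₚ.<⇒≤ 0<M) (0≤- S≤Pc))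
                  (*-nonneg (ℚₚ.<⇒≤ (ι-pos m)) (0≤- 1≤c)))
             (0≤- (subst (ℚ._≤ S) (ι-suc (suc p)) (ι-mono (s≤s p<m)))))
        (solve 3 (λ S P c → S :* ((S :+ S) :+ c)
             :+ ((S :+ S) :* (P :* c :- S) :+ S :* (c :- con 1ℚ) :+ (S :- (con 1ℚ :+ P)))
           := (con 1ℚ :+ P) :* ((S :+ S) :* c :- con 1ℚ)) refl S P c))
      (ℚₚ.≤-reflexive (sym eq)))
    where
    P c : ℚ
    P = ι (suc p)
    c = cot p
    S≤Pc : S ℚ.≤ P ℚ.* c
    S≤Pc = cot-large p (ℕₚ.<⇒≤ p<m)
    1≤c : 1ℚ ℚ.≤ c
    1≤c = ≤⇒1≤cot p (ℕₚ.<⇒≤ p<m) S≤Pc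
    0<M+c : 0ℚ ℚ.< M ℚ.+ c
    0<M+c = 0<M+ 1≤c
    eq : ι (suc (suc p)) ℚ.* cot (suc p) ℚ.* (M ℚ.+ c) ≡ (1ℚ ℚ.+ P) ℚ.* (M ℚ.* c ℚ.- 1ℚ)
    eq = trans (solve 4 (λ i x v d → i :* (x :* v) :* d := i :* x :* (d :* v)) refl
                  (ι (suc (suc p))) (M ℚ.* c ℚ.- 1ℚ) (inv (M ℚ.+ c)) (M ℚ.+ c))
           (trans (cong₂ ℚ._*_ (cong (ℚ._* (M ℚ.* c ℚ.- 1ℚ)) (ι-suc (suc p))) (inv-*ʳ 0<M+c))
                  (ℚₚ.*-identityʳ _))

  1≤cot : ∀ p → p ≤ m → 1ℚ ℚ.≤ cot p
  1≤cot p p≤m = ≤⇒1≤cot p p≤m (cot-large p p≤m)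

  cot-suc : ∀ p → p ≤ m → cot (suc p) ℚ.* (M ℚ.+ cot p) ≡ M ℚ.* cot p ℚ.- 1ℚ
  cot-suc p p≤m = trans
    (solve 3 (λ x v d → x :* v :* d := x :* (d :* v)) refl
      (M ℚ.* cot p ℚ.- 1ℚ) (inv (M ℚ.+ cot p)) (M ℚ.+ cot p))
    (trans (cong ((M ℚ.* cot p ℚ.- 1ℚ) ℚ.*_) (inv-*ʳ (0<M+ (1≤cot p p≤m)))) (ℚₚ.*-identityʳ _))

  -- The addition formula, multiplied out; the index `suc (p + d)` arises because
  -- `(p + 1) + (d + 1) = (p + d + 1) + 1`. Induction on `p` for all `d`: `cot-shift` moves one α
  -- from the second summand to the first.
  cot-+ : ∀ p d → suc (p ℕ.+ d) ≤ m →
          cot (suc (p ℕ.+ d)) ℚ.* (cot p ℚ.+ cot d) ≡ cot p ℚ.* cot d ℚ.- 1ℚ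
  cot-+ zero    d le = cot-suc d (ℕₚ.<⇒≤ le)
  cot-+ (suc p) d le = cot-shift (cot p) (cot (suc p)) (cot d) (cot (suc d)) (cot (suc (suc (p ℕ.+ d)))) M 0<M
    (ℚₚ.<-≤-trans 0<1 (ℚₚ.≤-trans (1≤cot p p≤m)
      (≤-by (cot (suc d)) (ℚₚ.≤-trans (ℚₚ.<⇒≤ 0<1) (1≤cot (suc d) d<m)) refl)))
    (cot-suc p p≤m) (cot-suc d (ℕₚ.<⇒≤ d<m))
    (subst (λ k → cot (suc k) ℚ.* (cot p ℚ.+ cot (suc d)) ≡ cot p ℚ.* cot (suc d) ℚ.- 1ℚ)
      (ℕₚ.+-suc p d) (cot-+ p (suc d) (subst (λ k → suc k ≤ m) (sym (ℕₚ.+-suc p d)) le)))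
    where
    p≤m : p ≤ m
    p≤m = ℕₚ.≤-trans (ℕₚ.m≤m+n p d) (ℕₚ.≤-trans (ℕₚ.n≤1+n _) (ℕₚ.<⇒≤ le))
    d<m : suc d ≤ m
    d<m = ℕₚ.≤-trans (s≤s (ℕₚ.m≤n+m d p)) (ℕₚ.<⇒≤ le)

  cot-difference : ∀ p d → suc (p ℕ.+ d) ≤ m →
    1ℚ ℚ.+ cot p ℚ.* cot (suc (p ℕ.+ d)) ≡ cot d ℚ.* (cot p ℚ.- cot (suc (p ℕ.+ d)))
  cot-difference p d le = trans
    (solve 3 (λ a b c → con 1ℚ :+ a :* c := (c :* (a :+ b) :+ con 1ℚ) :- c :* b) refl a b c)
    (trans (cong (λ z → (z ℚ.+ 1ℚ) ℚ.- c ℚ.* b) (cot-+ p d le))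
      (solve 3 (λ a b c → ((a :* b :- con 1ℚ) :+ con 1ℚ) :- c :* b := b :* (a :- c)) refl a b c))
    where
    a b c : ℚ
    a = cot p
    b = cot d
    c = cot (suc (p ℕ.+ d))

  0<cot : ∀ p → p ≤ m → 0ℚ ℚ.< cot p
  0<cot p p≤m = ℚₚ.<-≤-trans 0<1 (1≤cot p p≤m)

  -- Otherwise the right side of `cot-difference` would be at most zero, while its left side is at
  -- least one.
  cot-decreasing : ∀ {p q} → p ℕ.< q → q ≤ m → cot q ℚ.< cot p
  cot-decreasing {p} p<q q≤m with ℕₚ.m≤n⇒∃[o]m+o≡n p<q
  ... | d , refl = ℚₚ.≰⇒> λ cp≤cq → ℚₚ.<-irrefl refl
    (ℚₚ.<-≤-trans
      (ℚₚ.<-≤-trans 0<1 (≤-by _ (*-nonneg (ℚₚ.<⇒≤ (0<cot p p≤m)) (ℚₚ.<⇒≤ (0<cot _ q≤m))) refl))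
      (ℚₚ.≤-trans (ℚₚ.≤-reflexive (cot-difference p d q≤m))
        (subst (cot d ℚ.* (cot p ℚ.- cot (suc (p ℕ.+ d))) ℚ.≤_) (ℚₚ.*-zeroʳ (cot d))
          (ℚₚ.*-monoˡ-≤-nonNeg (cot d) {{ℚ.nonNegative (ℚₚ.<⇒≤ (0<cot d d≤m))}}
            (subst (cot p ℚ.- cot (suc (p ℕ.+ d)) ℚ.≤_) (ℚₚ.+-inverseʳ (cot (suc (p ℕ.+ d))))
              (ℚₚ.+-monoˡ-≤ (ℚ.- cot (suc (p ℕ.+ d))) cp≤cq))))))
    where
    p≤m : p ≤ m
    p≤m = ℕₚ.≤-trans (ℕₚ.n≤1+n p) (ℕₚ.≤-trans (ℕₚ.m≤m+n (suc p) d) q≤m)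
    d≤m : d ≤ m
    d≤m = ℕₚ.≤-trans (ℕₚ.m≤n+m d (suc p)) q≤m

  cot-injective : ∀ {p q} → p ≤ m → q ≤ m → cot p ≡ cot q → p ≡ q
  cot-injective {p} {q} p≤m q≤m e with ℕₚ.<-cmp p q
  ... | tri< p<q _ _ = contradiction (cot-decreasing p<q q≤m) (ℚₚ.<-irrefl (sym e))
  ... | tri≈ _ p≡q _ = p≡q
  ... | tri> _ _ q<p = contradiction (cot-decreasing q<p p≤m) (ℚₚ.<-irrefl e)

  -- The first row holds the cotangents of α, ..., mα, shared by the angles at the apex and those
  -- opening to the left. The second holds those of π - iα for `2 ≤ i ≤ m + 1`: it starts at `i = 2`
  -- because cot α is the rightmost point.
  value : Fin 2 → Fin m → ℚ
  value F.zero    d = cot (toℕ d)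
  value (F.suc _) d = ℚ.- cot (suc (toℕ d))

  IsValue : ℚ → Set
  IsValue c = Σ[ i ∈ Fin 2 ] Σ[ d ∈ Fin m ] c ≡ value i d

  cot-isValue : ∀ {d} → d ℕ.< m → IsValue (cot d)
  cot-isValue d<m = F.zero , fromℕ< d<m , cong cot (sym (Fₚ.toℕ-fromℕ< d<m))

  -cot-isValue : ∀ {d} → d ℕ.< m → IsValue (ℚ.- cot (suc d))
  -cot-isValue d<m = F.suc F.zero , fromℕ< d<m , cong (ℚ.-_ ∘ cot ∘ suc) (sym (Fₚ.toℕ-fromℕ< d<m))

  ray : ℕ → ℚPoint
  ray p = axis (cot p)

  cross-apex : ∀ t → crossAt (axis t) apex (axis t) ≡ 0ℚ
  cross-apex = solve 1 (λ t → (t :- con 0ℚ) :* (con 0ℚ :- con 1ℚ)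
    :- (con 0ℚ :- con 1ℚ) :* (t :- con 0ℚ) := con 0ℚ) refl

  cross-base : ∀ t → crossAt apex (axis t) (axis t) ≡ 0ℚ
  cross-base = solve 1 (λ t → (con 0ℚ :- t) :* (con 0ℚ :- con 0ℚ)
    :- (con 1ℚ :- con 0ℚ) :* (t :- t) := con 0ℚ) refl

  apex-isValue-< : ∀ {p q} → p ℕ.< q → q ≤ m → IsValue (cotAt (ray p) apex (ray q))
  apex-isValue-< {p} {q} p<q q≤m with ℕₚ.m≤n⇒∃[o]m+o≡n p<q
  ... | d , refl = subst IsValue
    (sym (cot-apex (cot p) (cot q) (cot d) (cot-decreasing p<q q≤m) (cot-difference p d q≤m)))
    (cot-isValue (ℕₚ.≤-trans (s≤s (ℕₚ.m≤n+m d p)) q≤m))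

  apex-isValue : ∀ {p q} → p ≤ m → q ≤ m → crossAt (ray p) apex (ray q) ≢ 0ℚ →
                 IsValue (cotAt (ray p) apex (ray q))
  apex-isValue {p} {q} p≤m q≤m X≢0 with ℕₚ.<-cmp p q
  ... | tri< p<q _ _  = apex-isValue-< p<q q≤m
  ... | tri≈ _ refl _ = contradiction (cross-apex (cot p)) X≢0
  ... | tri> _ _ q<p  = subst IsValue (cotAt-sym (ray q) apex (ray p)) (apex-isValue-< q<p p≤m)

  base-isValue : ∀ {p q} → p ≤ m → q ≤ m → crossAt apex (ray p) (ray q) ≢ 0ℚ →
                 IsValue (cotAt apex (ray p) (ray q))
  base-isValue {p} {q} p≤m q≤m X≢0 with ℕₚ.<-cmp p q
  base-isValue {p} {q} p≤m q≤m X≢0 | tri< p<q _ _ =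
    subst IsValue (sym (cot-left (cot p) (cot q) (cot-decreasing p<q q≤m)))
      (cot-isValue (ℕₚ.≤-trans p<q q≤m))
  base-isValue {p} {q} p≤m q≤m X≢0 | tri≈ _ refl _ = contradiction (cross-base (cot p)) X≢0
  -- `q < p` rules out index zero, and the predecessor is below `m`, as the second row of `value`
  -- requires.
  base-isValue {suc p} {q} p≤m q≤m X≢0 | tri> _ _ q<p =
    subst IsValue (sym (cot-right (cot (suc p)) (cot q) (cot-decreasing q<p p≤m)))
      (-cot-isValue p≤m)

-- Numbering the elements of a disjoint union

flatten : ∀ {k} (r : Vec ℕ k) i → Fin (lookup r i) → Fin (sum r)
flatten (n ∷ r) F.zero    a = a ↑ˡ sum r
flatten (n ∷ r) (F.suc i) a = n ↑ʳ flatten r i a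

flatten-injective : ∀ {k} (r : Vec ℕ k) {x y : Σ[ i ∈ Fin k ] Fin (lookup r i)} →
  uncurry (flatten r) x ≡ uncurry (flatten r) y → x ≡ y
flatten-injective (n ∷ r) {F.zero , a} {F.zero , b} e =
  cong (F.zero ,_) (Fₚ.↑ˡ-injective (sum r) a b e)
flatten-injective (n ∷ r) {F.zero , a} {F.suc j , b} e
  with () ← trans (sym (Fₚ.splitAt-↑ˡ n a (sum r)))
                  (trans (cong (splitAt n) e) (Fₚ.splitAt-↑ʳ n (sum r) (flatten r j b)))
flatten-injective (n ∷ r) {F.suc i , a} {F.zero , b} e
  with () ← trans (sym (Fₚ.splitAt-↑ˡ n b (sum r)))
                  (trans (cong (splitAt n) (sym e)) (Fₚ.splitAt-↑ʳ n (sum r) (flatten r i a)))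
flatten-injective (n ∷ r) {F.suc i , a} {F.suc j , b} e
  with flatten-injective r {i , a} {j , b} (Fₚ.↑ʳ-injective n _ _ e)
... | refl = refl

-- Cardinalities

covered⇒¬HasDistinct : ∀ T {B} (g : Fin B → ℝ) → (∀ θ → T θ → ∃[ b ] θ ≈ g b) →
                       ¬ HasDistinct T (suc B)
covered⇒¬HasDistinct T g cover (f , f∈T , f-injective)
  with Fₚ.pigeonhole (ℕₚ.n<1+n _) (λ i → proj₁ (cover (f i) (f∈T i)))
... | i , j , i<j , e = Fₚ.<⇒≢ i<j (f-injective (≈-trans (f i) (g _) (f j)
  (proj₂ (cover (f i) (f∈T i)))
  (≈-sym (f j) (g _) (subst (λ b → f j ≈ g b) (sym e) (proj₂ (cover (f j) (f∈T j)))))))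

-- Descent on `B`: either there are `B` distinct elements and the size is `B`, or the bound drops by
-- one. This case distinction is undecidable, hence the double negation.
¬HasDistinct⇒HasSize : ∀ T B → ¬ HasDistinct T (suc B) →
                       ¬ ¬ (∃[ n ] n ≤ B × HasSize T n)
¬HasDistinct⇒HasSize T zero    none k = k (0 , z≤n , ((λ ()) , (λ ()) , λ { {()} }) , none)
¬HasDistinct⇒HasSize T (suc B) none k = ¬HasDistinct⇒HasSize T B
  (λ d → k (suc B , ℕₚ.≤-refl , d , none))
  λ (n , n≤B , size) → k (n , ℕₚ.m≤n⇒m≤1+n n≤B , size)

-- If no least element existed, well-founded induction would refute every `P n`.
¬¬-least : ∀ {P : ℕ → Set} {n} → P n → ¬ ¬ (∃[ l ] P l × (∀ n → P n → l ≤ n))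
¬¬-least {P} {n} Pn none = ℕInd.<-rec (¬_ ∘ P)
  (λ n ih Pn → none (n , Pn , λ l Pl → ℕₚ.≮⇒≥ λ l<n → ih l<n Pl)) n Pn

-- The configuration

module _ {k} (r₀ r₁ r₂ : ℕ) (rs : Vec ℕ k) where

  outer sizes : Vec ℕ _
  outer = suc r₁ ∷ suc r₂ ∷ rs
  sizes = suc r₀ ∷ outer

  -- The sets other than the first have `sum outer` points altogether, and the fan with parameter
  -- `m` has `m + 1`.
  open Fan (ℕ.pred (sum outer))

  index : ∀ i → Fin (lookup outer i) → ℕ
  index i a = toℕ (flatten outer i a)

  index≤ : ∀ i a → index i a ≤ ℕ.pred (sum outer)
  index≤ i a = ℕₚ.≤-pred (Fₚ.toℕ<n (flatten outer i a))

  -- The remaining points of the first set sit at negative integers, apart from the positive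
  -- cotangents.
  position : ∀ i → Fin (lookup sizes i) → ℚPoint
  position F.zero    F.zero    = apex
  position F.zero    (F.suc a) = axis (ℚ.- ι (suc (toℕ a)))
  position (F.suc i) a         = ray (index i a)

  -ι≢cot : ∀ n {p} → p ≤ ℕ.pred (sum outer) → ℚ.- ι (suc n) ≢ cot p
  -ι≢cot n {p} p≤ e = ℚₚ.<-irrefl e
    (ℚₚ.<-trans (ℚₚ.neg-antimono-< (ι-pos n)) (0<cot p p≤))

  ι-injective : ∀ {m n} → ι m ≡ ι n → m ≡ n
  ι-injective refl = refl

  position-injective : ∀ {x y : Σ[ i ∈ Fin _ ] Fin (lookup sizes i)} →
                       uncurry position x ≡ uncurry position y → x ≡ y
  position-injective {F.zero , F.zero}  {F.zero , F.zero}  _ = refl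
  position-injective {F.zero , F.zero}  {F.zero , F.suc b} ()
  position-injective {F.zero , F.zero}  {F.suc j , b}      ()
  position-injective {F.zero , F.suc a} {F.zero , F.zero}  ()
  position-injective {F.zero , F.suc a} {F.zero , F.suc b} e =
    cong (λ z → F.zero , F.suc z)
      (Fₚ.toℕ-injective (ℕₚ.suc-injective (ι-injective (ℚₚ.neg-injective (cong proj₁ e)))))
  position-injective {F.zero , F.suc a} {F.suc j , b}      e =
    contradiction (cong proj₁ e) (-ι≢cot (toℕ a) (index≤ j b))
  position-injective {F.suc i , a}      {F.zero , F.zero}  ()
  position-injective {F.suc i , a}      {F.zero , F.suc b} e =
    contradiction (sym (cong proj₁ e)) (-ι≢cot (toℕ b) (index≤ i a))
  position-injective {F.suc i , a}      {F.suc j , b}      e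
    with flatten-injective outer {i , a} {j , b}
           (Fₚ.toℕ-injective (cot-injective (index≤ i a) (index≤ j b) (cong proj₁ e)))
  ... | refl = refl

  fan : Configuration sizes
  fan = record
    { point        = λ i a → embed (position i a)
    ; distinct     = λ {x} {y} e →
        position-injective (embed-injective (uncurry position x) (uncurry position y) e)
    ; notCollinear = λ (ℓ , on) → apex-noncollinear ℓ axis-points-differ
        (on F.zero F.zero) (on (F.suc F.zero) F.zero) (on (F.suc (F.suc F.zero)) F.zero)
    }
    where
    axis-points-differ : cot (index F.zero F.zero) ≢ cot (index (F.suc F.zero) F.zero)
    axis-points-differ e with () ← position-injective
      {F.suc F.zero , F.zero} {F.suc (F.suc F.zero) , F.zero} (cong axis e)

  axial : ∀ i → Fin (lookup outer i) → ℚ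
  axial i a = cot (index i a)

  negative : Fin r₀ → ℚ
  negative a = ℚ.- ι (suc (toℕ a))

  -- Distinct indices allow at most one point from the first set. Unless that point is the apex, all
  -- three points lie on the axis and the cross product vanishes.
  cot-isValue-of : ∀ i j l → i ≢ j → j ≢ l → i ≢ l → ∀ a b c →
    crossAt (position i a) (position j b) (position l c) ≢ 0ℚ →
    IsValue (cotAt (position i a) (position j b) (position l c))
  cot-isValue-of F.zero    F.zero    _         i≢j _   _   = contradiction refl i≢j
  cot-isValue-of F.zero    (F.suc _) F.zero    _   _   i≢l = contradiction refl i≢l
  cot-isValue-of (F.suc _) F.zero    F.zero    _   j≢l _   = contradiction refl j≢l
  cot-isValue-of F.zero    (F.suc j) (F.suc l) _ _ _ F.zero b c =
    base-isValue (index≤ j b) (index≤ l c)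
  cot-isValue-of (F.suc i) F.zero    (F.suc l) _ _ _ a F.zero c =
    apex-isValue (index≤ i a) (index≤ l c)
  cot-isValue-of (F.suc i) (F.suc j) F.zero    _ _ _ a b F.zero X≢0 =
    subst IsValue (cotAt-sym apex (ray (index j b)) (ray (index i a)))
      (base-isValue (index≤ j b) (index≤ i a) λ X≡0 →
        X≢0 (trans (crossAt-swap (ray (index i a)) (ray (index j b)) apex) (cong ℚ.-_ X≡0)))
  cot-isValue-of F.zero    (F.suc j) (F.suc l) _ _ _ (F.suc a) b c X≢0 =
    contradiction (axis-cross (negative a) (axial j b) (axial l c)) X≢0
  cot-isValue-of (F.suc i) F.zero    (F.suc l) _ _ _ a (F.suc b) c X≢0 =
    contradiction (axis-cross (axial i a) (negative b) (axial l c)) X≢0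
  cot-isValue-of (F.suc i) (F.suc j) F.zero    _ _ _ a b (F.suc c) X≢0 =
    contradiction (axis-cross (axial i a) (axial j b) (negative c)) X≢0
  cot-isValue-of (F.suc i) (F.suc j) (F.suc l) _ _ _ a b c X≢0 =
    contradiction (axis-cross (axial i a) (axial j b) (axial l c)) X≢0

  fan-angles : ¬ HasDistinct (AngleOf fan) (suc (2 * ℕ.pred (sum outer)))
  fan-angles = covered⇒¬HasDistinct (AngleOf fan) (angle ∘ remQuot (ℕ.pred (sum outer))) cover
    where
    -- `remQuot` and `combine` identify `Fin (2 * m)` with the two rows of `value`, so the list has
    -- exactly the length of the bound.
    angle : Fin 2 × Fin (ℕ.pred (sum outer)) → ℝ
    angle (i , d) = arccot (fromℚ (value i d))
    cover : ∀ θ → AngleOf fan θ → ∃[ b ] θ ≈ angle (remQuot (ℕ.pred (sum outer)) b)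
    cover θ (i , j , l , i≢j , j≢l , i≢l , (a , b , c , θ-angle) , 0<θ , θ<π)
      with angle-rational (position i a) (position j b) (position l c) θ-angle 0<θ θ<π
    ... | X≢0 , θ≈ with cot-isValue-of i j l i≢j j≢l i≢l a b c X≢0
    ... | e , d , cot≡ = combine e d ,
      subst (λ x → θ ≈ angle x) (sym (Fₚ.remQuot-combine e d))
        (subst (λ x → θ ≈ arccot (fromℚ x)) cot≡ θ≈)

  A-bound : (¬ ¬ ∃ (IsA sizes)) × (∀ m → IsA sizes m → m ≤ 2 * ℕ.pred (sum outer))
  A-bound =
    (λ none → ¬HasDistinct⇒HasSize (AngleOf fan) _ fan-angles λ (n , _ , size) →
      ¬¬-least {λ n → Σ[ C ∈ Configuration sizes ] HasSize (AngleOf C) n} (fan , size)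
        λ (l , attained , least) → none (l , attained , λ C n size → least n (C , size))) ,
    -- The size of the fan's angle set is known only up to double negation; decidability of `≤` on
    -- naturals removes it.
    λ n (_ , least) → decidable-stable (n ℕₚ.≤? _) λ n≰ →
      ¬HasDistinct⇒HasSize (AngleOf fan) _ fan-angles λ (l , l≤ , size) → n≰ (ℕₚ.≤-trans (least fan l size) l≤)

lemma5p8 : ∀ k (r : Vec ℕ (suc k)) → 3 ≤ suc k → Linked _≥_ r → All (1 ≤_) r →
    (¬ ¬ ∃ (IsA r)) × (∀ m → IsA r m → m ≤ 2 * (sum r ∸ head r ∸ 1))
lemma5p8 (suc (suc k)) (suc r₀ ∷ suc r₁ ∷ suc r₂ ∷ rs) _ _ _ =
  -- Removing the head from the sum leaves `sum outer`, which is a successor, so `∸ 1` and `pred`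
  -- agree on it.
  proj₁ A , λ m m-is-A → subst (λ s → m ≤ 2 * (s ∸ 1)) (sym (ℕₚ.m+n∸m≡n (suc r₀) _)) (proj₂ A m m-is-A)
  where
  A = A-bound r₀ r₁ r₂ rs
lemma5p8 (suc zero) _ (s≤s (s≤s ())) _ _
lemma5p8 zero       _ (s≤s ()) _ _
lemma5p8 _ (zero ∷ _)                 _ _ (() ∷ _)
lemma5p8 _ (_ ∷ zero ∷ _)             _ _ (_ ∷ () ∷ _)
lemma5p8 _ (_ ∷ _ ∷ zero ∷ _)         _ _ (_ ∷ _ ∷ () ∷ _)
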